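{- Let $\sigma=(M_1,M_2)$ be a schedule of $n$ jobs on two identical machines and $k\ge 2$. The derandomized $k$-swap algorithm, which deterministically finds an improving neighbor of $\sigma$ obtained by interchanging exactly $k$ jobs between the two machines whenever one exists, terminates in $O(k^{9}\cdot n^{\lceil k/2\rceil}\cdot \log n\cdot \log k)$ steps.
   Context: Problem $P2\|C_{\max}$: $n$ jobs with processing times $p_j>0$, two identical machines. A schedule $\sigma=(M_1,M_2)$ partitions the jobs into the sets processed on machines 1 and 2; loads $L_i=\sum_{j\in M_i}p_j$, makespan $L_{\max}=\max_iL_i$, $L_{\min}=\min_iL_i$, $\Delta=L_{\max}-L_{\min}$; the critical machine has load $L_{\max}$. An improving neighbor obtained by interchanging exactly $k$ jobs consists of a set $S'$ of jobs on the critical machine and a set $S''$ on the other machine with $|S'|+|S''|=k$ and $0<\sum_{j\in S'}p_j-\sum_{j\in S''}p_j<\Delta$; interchanging them strictly decreases the makespan. Randomized $k$-swap algorithm (machine 1 critical): split the jobs into sets $A,B$; form $A_\Sigma$ = values $\sum_{j\in S_1\cap M_1}p_j-\sum_{j\in S_1\cap M_2}p_j$ over $S_1\subseteq A$, $|S_1|=\lceil k/2\rceil$, and $B_\Sigma$ likewise over $S_2\subseteq B$, $|S_2|=\lfloor k/2\rfloor$; sort $B_\Sigma$; for each $x\in A_\Sigma$ binary-search for $y\in B_\Sigma$ with $-x<y<\Delta-x$, and if found interchange the jobs of $S_1\cup S_2$. In the randomized version the split into $A,B$ is uniformly random. The derandomized $k$-swap algorithm instead runs this procedure once for each split of the jobs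 into $A,B$ obtained from an $(n,k,k^2)$-splitter (a family $H$ of functions $\{1,\dots,n\}\to\{1,\dots,k^2\}$ of size $k^6\log k\log n$ such that every $k$-subset is mapped injectively by some $h\in H$) composed with $2k^2$ fixed maps $\{1,\dots,k^2\}\to\{0,1\}$ (jobs mapped to 0 form $A$, to 1 form $B$), i.e. $O(k^8\log k\log n)$ runs in total.
   Formalization: The bound is shown for a modified algorithm: subset sums are sorted once before all runs, x is taken in decreasing order and each search resumes where the last ended; sorting B_Σ and fully binary-searching it in every run costs an extra factor log n. The splitter is given, not built. -}

module Defs where

open import Algebra.Core using (Op₁; Op₂)
open import Algebra.Structures using (IsAbelianGroup)
open import Data.Bool using (Bool; true; false; if_then_else_; not)
open import Data.Fin using (Fin; zero; suc; toℕ; opposite)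
import Data.Fin as Fin
open import Data.Fin.Patterns using (0F; 1F)
open import Data.Fin.Subset using (Subset; inside; outside; _∈_; _⊆_; ∣_∣; ⁅_⁆; ⋃)
open import Data.List as List using (List; []; _∷_; _++_; allFin; cartesianProductWith)
open import Data.List.Relation.Unary.Any using (Any)
open import Data.Maybe using (Maybe; just; nothing)
open import Data.Nat as ℕ using (ℕ; zero; suc; _^_; _*_; ⌈_/2⌉; ⌊_/2⌋)
open import Data.Nat.Logarithm using (⌈log₂_⌉)
open import Data.Product using (_×_; _,_)
open import Data.Unit using (⊤; tt)
open import Data.Vec as Vec using ([]; _∷_)
open import Function using (_∘_)
open import Relation.Binary.Core using (Rel)
open import Relation.Binary.PropositionalEquality using (_≡_)
open import Relation.Binary.Structures using (IsStrictTotalOrder)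
open import Relation.Nullary.Decidable using (does)
open import Level using (0ℓ)

-- Processing times live in an arbitrary totally ordered abelian group, since
-- only addition, negation and comparison of numbers are ever used.  ℤ and ℚ
-- are instances.

record OrderedAbelianGroup : Set₁ where
  infix  4 _<_
  infixl 6 _+_ _-_
  infix  8 -_
  field
    Carrier            : Set
    _<_                : Rel Carrier 0ℓ
    _+_                : Op₂ Carrier
    0#                 : Carrier
    -_                 : Op₁ Carrier
    isAbelianGroup     : IsAbelianGroup _≡_ _+_ 0# -_
    isStrictTotalOrder : IsStrictTotalOrder _≡_ _<_
    +-monoʳ-<          : ∀ x {y z} → y < z → x + y < x + z

  open IsStrictTotalOrder isStrictTotalOrder public using (_<?_)

  _-_ : Op₂ Carrier
  x - y = x + (- y)

Machine : Set
Machine = Fin 2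

Schedule : ℕ → Set
Schedule n = Fin n → Machine

jobsOn : ∀ {n} → Schedule n → Machine → Subset n
jobsOn σ i = Vec.tabulate (λ j → does (σ j Fin.≟ i))

------------------------------------------------------------------------
-- Splitters and splits

InjectiveOn : ∀ {n l} → Subset n → (Fin n → Fin l) → Set
InjectiveOn S h = ∀ {i j} → i ∈ S → j ∈ S → h i ≡ h j → i ≡ j

IsSplitter : ∀ {n l} → ℕ → List (Fin n → Fin l) → Set
IsSplitter {n} k H = ∀ (S : Subset n) → ∣ S ∣ ≡ k → Any (InjectiveOn S) H

below : ∀ {l} → Fin l → Fin l → Fin 2
below t i = if does (i Fin.<? t) then 0F else 1F

-- The 2l fixed maps: every threshold map together with its complement.
-- A threshold map cuts a subset of Fin l after any prescribed number of its
-- elements, so a k-subset can always be cut into ⌈k/2⌉ and ⌊k/2⌋ elements.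
twoColourings : ∀ l → List (Fin l → Fin 2)
twoColourings l =
  List.map below (allFin l) ++ List.map (λ t → opposite ∘ below t) (allFin l)

Split : ℕ → Set
Split n = Fin n → Fin 2

splits : ∀ {n l} → List (Fin n → Fin l) → List (Split n)
splits {l = l} H = cartesianProductWith (λ h g → g ∘ h) H (twoColourings l)

------------------------------------------------------------------------
-- Computations with a step count.  Unit-cost random access machine: one step
-- for each arithmetic operation, comparison and array access, and one step
-- (`tick`) for each unfolding of a recursive procedure, which covers the
-- bounded number of pointer operations done there.

record Timed (A : Set) : Set where
  field
    value : A
    steps : ℕ

open Timed public

infixl 1 _>>=_ _>>_

return : ∀ {A : Set} → A → Timed A
return x .value = x
return x .steps = 0

_>>=_ : ∀ {A B : Set} → Timed A → (A → Timed B) → Timed B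
(m >>= f) .value = f (m .value) .value
(m >>= f) .steps = m .steps ℕ.+ f (m .value) .steps

_>>_ : ∀ {A B : Set} → Timed A → Timed B → Timed B
m >> m′ = m >>= λ _ → m′

step : ∀ {A : Set} → A → Timed A
step x .value = x
step x .steps = 1

tick : Timed ⊤
tick = step tt

lengthᵗ : ∀ {A : Set} → List A → Timed ℕ
lengthᵗ []       = step 0
lengthᵗ (_ ∷ xs) = do
  l ← lengthᵗ xs
  step (suc l)

appendᵗ : ∀ {A : Set} → List A → List A → Timed (List A)
appendᵗ []       ys = step ys
appendᵗ (x ∷ xs) ys = do
  zs ← appendᵗ xs ys
  step (x ∷ zs)

at : ∀ {A : Set} → List A → ℕ → Maybe A
at []       _       = nothing
at (x ∷ _)  zero    = just x
at (_ ∷ xs) (suc i) = at xs i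

-- A list that has been built lies in an array, so reading an arbitrary
-- position takes one step.
_!_ : ∀ {A : Set} → List A → ℕ → Timed (Maybe A)
xs ! i = step (at xs i)

module MergeSort {A : Set} (_≤ᵗ_ : A → A → Timed Bool) where

  merge : List A → List A → Timed (List A)
  merge []       ys       = step ys
  merge (x ∷ xs) []       = step (x ∷ xs)
  merge (x ∷ xs) (y ∷ ys) = do
    tick
    x≤y ← x ≤ᵗ y
    if x≤y
      then (do zs ← merge xs (y ∷ ys)
               return (x ∷ zs))
      else (do zs ← merge (x ∷ xs) ys
               return (y ∷ zs))

  -- Sorts the first 2 ^ d elements and also returns the remaining ones.
  sortPrefix : ℕ → List A → Timed (List A × List A)
  sortPrefix zero    []       = step ([] , [])
  sortPrefix zero    (x ∷ xs) = step (x ∷ [] , xs)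
  sortPrefix (suc d) xs       = do
    tick
    ys , xs′  ← sortPrefix d xs
    zs , xs″  ← sortPrefix d xs′
    sorted    ← merge ys zs
    return (sorted , xs″)

  sort : List A → Timed (List A)
  sort xs = do
    l          ← lengthᵗ xs
    d          ← step ⌈log₂ l ⌉
    sorted , _ ← sortPrefix d xs
    return sorted

------------------------------------------------------------------------

module TwoMachines (𝔾 : OrderedAbelianGroup) {n : ℕ}
                   (p : Fin n → OrderedAbelianGroup.Carrier 𝔾)
                   (σ : Schedule n) where

  open OrderedAbelianGroup 𝔾

  ∑ : ∀ {m} → Subset m → (Fin m → Carrier) → Carrier
  ∑ []            f = 0#
  ∑ (inside  ∷ S) f = f zero + ∑ S (f ∘ suc)
  ∑ (outside ∷ S) f = ∑ S (f ∘ suc)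

  load : Machine → Carrier
  load i = ∑ (jobsOn σ i) p

  Lmax : Carrier
  Lmax = if does (load 0F <? load 1F) then load 1F else load 0F

  Lmin : Carrier
  Lmin = if does (load 0F <? load 1F) then load 0F else load 1F

  Δ : Carrier
  Δ = Lmax - Lmin

  record IsImprovingNeighbour (k : ℕ) (S′ S″ : Subset n) : Set where
    field
      machine     : Machine
      critical    : load machine ≡ Lmax
      S′-critical : S′ ⊆ jobsOn σ machine
      S″-other    : S″ ⊆ jobsOn σ (opposite machine)
      size        : ∣ S′ ∣ ℕ.+ ∣ S″ ∣ ≡ k
      positive    : 0# < ∑ S′ p - ∑ S″ p
      bounded     : ∑ S′ p - ∑ S″ p < Δ

  ----------------------------------------------------------------------
  -- The algorithm

  Jobs : Set
  Jobs = List (Fin n)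

  toSubset : Jobs → Subset n
  toSubset js = ⋃ (List.map ⁅_⁆ js)

  infix 4 _<ᵗ_
  infix 6 _+ᵗ_ _-ᵗ_

  _<ᵗ_ : Carrier → Carrier → Timed Bool
  x <ᵗ y = step (does (x <? y))

  _+ᵗ_ _-ᵗ_ : Carrier → Carrier → Timed Carrier
  x +ᵗ y = step (x + y)
  x -ᵗ y = step (x - y)

  _is_ : Fin 2 → Fin 2 → Timed Bool
  i is j = step (does (i Fin.≟ j))

  loadᵗ : Machine → Jobs → Timed Carrier
  loadᵗ i []       = step 0#
  loadᵗ i (j ∷ js) = do
    tick
    m    ← step (σ j)
    here ← m is i
    rest ← loadᵗ i js
    if here
      then (do x ← step (p j)
               x +ᵗ rest)
      else return rest

  -- The contribution of a job to Σ_{S ∩ M₁} p - Σ_{S ∩ M₂} p, where machine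
  -- c plays the role of the critical machine M₁.
  signed : Machine → Fin n → Timed Carrier
  signed c j = do
    m    ← step (σ j)
    here ← m is c
    x    ← step (p j)
    if here then return x else step (- x)

  -- A set of jobs together with its signed sum.
  Entry : Set
  Entry = Carrier × Jobs

  extend : Carrier → Fin n → List Entry → Timed (List Entry)
  extend x j []             = step []
  extend x j ((y , S) ∷ es) = do
    tick
    z   ← x +ᵗ y
    es′ ← extend x j es
    return ((z , j ∷ S) ∷ es′)

  -- All m-element subsets of the given jobs.
  choose : Machine → ℕ → Jobs → Timed (List Entry)
  choose c zero    js       = step ((0# , []) ∷ [])
  choose c (suc m) []       = step []
  choose c (suc m) (j ∷ js) = do
    tick
    x        ← signed c j
    smaller  ← choose c m js
    withj    ← extend x j smaller
    withoutj ← choose c (suc m) js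
    appendᵗ withj withoutj

  _≤ᵗ_ _≥ᵗ_ : Entry → Entry → Timed Bool
  (x , _) ≤ᵗ (y , _) = do
    y<x ← y <ᵗ x
    return (not y<x)
  e ≥ᵗ e′ = e′ ≤ᵗ e

  -- Two steps per job, because a split is a composite of two tables.
  colour : Split n → Fin n → Timed (Fin 2)
  colour χ j = do
    tick
    step (χ j)

  contained : Split n → Fin 2 → Jobs → Timed Bool
  contained χ a []       = step true
  contained χ a (j ∷ js) = do
    tick
    b ← colour χ j
    ok ← b is a
    if ok then contained χ a js else return false

  -- Keeps the entries whose jobs all have colour a, in the given order.
  select : Split n → Fin 2 → List Entry → Timed (List Entry)
  select χ a []             = step []
  select χ a ((x , S) ∷ es) = do
    tick
    keep ← contained χ a S
    es′  ← select χ a es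
    return (if keep then (x , S) ∷ es′ else es′)

  module BinarySearch (B : List Entry) (z : Carrier) where

    exceeds : ℕ → Timed Bool
    exceeds i = do
      e ← B ! i
      case e
      where
      case : Maybe Entry → Timed Bool
      case nothing        = return true
      case (just (y , _)) = z <ᵗ y

    -- The first of the positions lo, …, lo + 2 ^ d - 1 whose value exceeds
    -- z, provided that the last one does.
    bisect : ℕ → ℕ → Timed ℕ
    bisect zero    lo = step lo
    bisect (suc d) lo = do
      w  ← step (2 ^ d)
      hi ← step (lo ℕ.+ w)
      up ← exceeds (ℕ.pred hi)
      if up then bisect d lo else bisect d hi

    -- The first position from lo on whose value exceeds z, where positions
    -- past the end of B count as exceeding.  The range for bisection is found
    -- by doubling its width 2 ^ d; the first argument bounds the number of
    -- doublings.
    locate : ℕ → ℕ → ℕ → Timed ℕ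
    locate zero    d lo = step lo
    locate (suc f) d lo = do
      w  ← step (2 ^ d)
      hi ← step (lo ℕ.+ w)
      up ← exceeds (ℕ.pred hi)
      if up then bisect d lo else locate f (suc d) hi

  -- For each x in the first list, which is in decreasing order, a binary
  -- search in B, which is in increasing order, for y with -x < y < δ - x.
  -- As -x only grows, each search can start where the previous one ended.
  search : Carrier → (B : List Entry) → ℕ → List Entry → ℕ → Timed (Maybe Jobs)
  search δ B l []             lo = step nothing
  search δ B l ((x , S₁) ∷ as) lo = do
    -x ← step (- x)
    i  ← BinarySearch.locate B -x l 0 lo
    e  ← B ! i
    case e i
    where
    case : Maybe Entry → ℕ → Timed (Maybe Jobs)
    case nothing         i = search δ B l as i
    case (just (y , S₂)) i = do
      u   ← δ -ᵗ x
      y<u ← y <ᵗ u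
      if y<u
        then (do S ← appendᵗ S₁ S₂
                 return (just S))
        else search δ B l as i

  -- One run: `as` and `bs` list all ⌈k/2⌉-subsets by decreasing sum and all
  -- ⌊k/2⌋-subsets by increasing sum.  Selecting those inside A (colour 0) and
  -- inside B (colour 1) preserves the order.
  run : Carrier → List Entry → List Entry → Split n → Timed (Maybe Jobs)
  run δ as bs χ = do
    A-sums ← select χ 0F as
    B-sums ← select χ 1F bs
    l      ← lengthᵗ B-sums
    search δ B-sums l A-sums 0

  runAll : Carrier → List Entry → List Entry → List (Split n) → Timed (Maybe Jobs)
  runAll δ as bs []       = step nothing
  runAll δ as bs (χ ∷ χs) = do
    tick
    r ← run δ as bs χ
    case r
    where
    case : Maybe Jobs → Timed (Maybe Jobs)
    case (just S) = return (just S)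
    case nothing  = runAll δ as bs χs

  -- Divides a set of jobs into those on machine c and the others.
  separate : Machine → Jobs → Timed (Jobs × Jobs)
  separate c []       = step ([] , [])
  separate c (j ∷ js) = do
    tick
    m         ← step (σ j)
    here      ← m is c
    js′ , js″ ← separate c js
    return (if here then (j ∷ js′ , js″) else (js′ , j ∷ js″))

  -- The subset sums are sorted once, before the runs, so that every run forms
  -- A_Σ and B_Σ already in order.  Sorting B_Σ again in every run, or
  -- searching all of it for every x, would put a factor log n into the cost of
  -- a run, on top of the log n in the number of runs.
  derandomizedSwap : ∀ {l} → ℕ → List (Fin n → Fin l) → Timed (Maybe (Jobs × Jobs))
  derandomizedSwap k H = do
    L₀    ← loadᵗ 0F (allFin n)
    L₁    ← loadᵗ 1F (allFin n)
    L₀<L₁ ← L₀ <ᵗ L₁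
    δ     ← (if L₀<L₁ then L₁ -ᵗ L₀ else L₀ -ᵗ L₁)
    let c = if L₀<L₁ then 1F else 0F
    as₀   ← choose c ⌈ k /2⌉ (allFin n)
    as    ← MergeSort.sort _≥ᵗ_ as₀
    bs₀   ← choose c ⌊ k /2⌋ (allFin n)
    bs    ← MergeSort.sort _≤ᵗ_ bs₀
    r     ← runAll δ as bs (splits H)
    finish c r
    where
    finish : Machine → Maybe Jobs → Timed (Maybe (Jobs × Jobs))
    finish c nothing  = return nothing
    finish c (just S) = do
      S′ , S″ ← separate c S
      return (just (S′ , S″))

module Submission where

open import Defs
import Algebra.Properties.AbelianGroup
import Algebra.Properties.CommutativeSemigroup
open import Algebra.Bundles using (AbelianGroup)
open import Data.Bool using (Bool; true; false; if_then_else_)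
open import Data.Empty using (⊥-elim)
open import Data.Fin using (Fin; zero; suc; toℕ; fromℕ<; opposite)
import Data.Fin as Fin
open import Data.Fin.Patterns using (0F; 1F)
open import Data.Fin.Properties using (toℕ-injective; toℕ-fromℕ<; toℕ<n)
open import Data.Fin.Subset using (Subset; ⁅_⁆; ∣_∣; ⊥; inside; outside; _∪_)
  renaming (_∈_ to _∈ₛ_; _∉_ to _∉ₛ_; _⊆_ to _⊆ₛ_)
open import Data.Fin.Subset.Properties
  using (∪-identityˡ; ∉⊥; ∣⊥∣≡0; x∈⁅x⁆; x∈⁅y⁆⇒x≡y; x∈p∪q⁻; x∈p∪q⁺; ⊆-antisym; drop-not-there)
  renaming (_∈?_ to _∈ₛ?_)
open import Data.List
  using (List; []; _∷_; _++_; length; drop; filter; map; foldr; tabulate; allFin; cartesianProductWith)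
open import Data.List.Membership.Propositional using (_∈_; find)
open import Data.List.Membership.Propositional.Properties
  using (∈-++⁺ˡ; ∈-++⁺ʳ; ∈-map⁺; ∈-filter⁺; ∈-filter⁻; ∈-allFin; ∈-cartesianProductWith⁺)
open import Data.List.Properties
  using (++-identityʳ; drop-all; drop-drop; filter-all; filter-none; length-++; length-filter; length-map; length-tabulate)
open import Data.List.Relation.Binary.Permutation.Propositional
  using (_↭_; ↭-refl; ↭-sym; ↭-trans; ↭-reflexive; prep; module PermutationReasoning)
import Data.List.Relation.Binary.Permutation.Propositional.Properties as Perm
open import Data.List.Relation.Binary.Sublist.Propositional using (_⊆_; []; _∷_; _∷ʳ_; minimum; ⊆-trans)
open import Data.List.Relation.Binary.Sublist.Propositional.Properties using (All-resp-⊆; filter-⊆)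
open import Data.List.Relation.Unary.All as All using (All; []; _∷_)
import Data.List.Relation.Unary.All.Properties as All
open import Data.List.Relation.Unary.AllPairs as AllPairs using (AllPairs; []; _∷_)
import Data.List.Relation.Unary.AllPairs.Properties as AllPairs
open import Data.List.Relation.Unary.Any using (here; there)
open import Data.List.Relation.Unary.Unique.Propositional using (Unique)
import Data.List.Relation.Unary.Unique.Propositional.Properties as Unique
open import Data.Maybe as Maybe using (Maybe; just; nothing; maybe)
open import Data.Nat hiding (compare)
open import Data.Nat.Induction using (<-rec)
open import Data.Nat.Logarithm
open import Data.Nat.Properties
open import Data.Nat.Tactic.RingSolver using (solve-∀)
open import Data.Product using (∃; ∃₂; _×_; _,_; proj₁; proj₂)
open import Data.Sum using (inj₁; inj₂)
open import Data.Vec as Vec using (_∷_; here)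
open import Data.Vec.Properties using ([]=⇒lookup; lookup⇒[]=; lookup∘tabulate)
open import Function using (_∘_; id)
open import Relation.Binary.Definitions using (tri<; tri≈; tri>)
open import Relation.Binary.PropositionalEquality
open import Relation.Binary.Structures using (IsStrictTotalOrder)
open import Relation.Nullary using (¬_; Dec; does; yes; no; contradiction)
open import Relation.Nullary.Decidable using (dec-true; dec-false)
open import Relation.Unary using (Decidable)
open import Relation.Unary.Properties using (∁?)

-- Correctness.  Cutting the image of an improving k-set under an injective
-- hash function at the right threshold separates it into ⌈k/2⌉ and ⌊k/2⌋ jobs,
-- so one of the splits puts these halves into A and B.  In that run, while x
-- decreases, every position passed in B holds a value at most -x and stays
-- useless for all later x; the first position exceeding -x holds the least
-- candidate y, hence testing it alone suffices.
--
-- Running time.  A search moving from position lo to i costs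
-- O(1 + log(i - lo)) ≤ O(1 + i - lo), so the searches of a run telescope to
-- O(|A| + |B|), which is O(n ^ ⌈k/2⌉) since ∑ᵢ≤ₘ C(n,i) ≤ 1 + n ^ m.  Checking
-- the colours of the subsets contributes another factor k, and there are
-- 2k² |H| runs; sorting the subset sums once costs only O(k n ^ ⌈k/2⌉ log n).

-- The telescoping is a potential argument with potential `8 * lo`. A failed doubling costs 4 steps
-- at once and up to 4 more later, since it deepens the final bisection by one level; as it also
-- advances the position by at least 1, a weight of 8 per position pays for both. Completeness
-- cannot promise the neighbour that was assumed to exist: an earlier split or an earlier x may
-- produce another one. It therefore claims only that the result is not `nothing`, and soundness
-- separately shows that every result is an improving neighbour. Subsets of jobs appear in two
-- forms, as lists inside the algorithm and as `Subset n` in the specification. The lists are kept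
-- as sublists of `allFin n`, which makes them free of repetitions and gives every set exactly one
-- list.

n≤2^⌈log₂n⌉ : ∀ n → n ≤ 2 ^ ⌈log₂ n ⌉
n≤2^⌈log₂n⌉ = <-rec _ go
  where
  n≤2*⌈n/2⌉ : ∀ n → n ≤ 2 * ⌈ n /2⌉
  n≤2*⌈n/2⌉ n = begin
    n                     ≡⟨ ⌊n/2⌋+⌈n/2⌉≡n n ⟨
    ⌊ n /2⌋ + ⌈ n /2⌉     ≤⟨ +-monoˡ-≤ ⌈ n /2⌉ (⌊n/2⌋≤⌈n/2⌉ n) ⟩
    ⌈ n /2⌉ + ⌈ n /2⌉     ≡⟨ cong (⌈ n /2⌉ +_) (+-identityʳ _) ⟨
    2 * ⌈ n /2⌉           ∎
    where open ≤-Reasoning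

  go : ∀ n → (∀ {m} → m < n → m ≤ 2 ^ ⌈log₂ m ⌉) → n ≤ 2 ^ ⌈log₂ n ⌉
  go 0 _ = z≤n
  go 1 _ = m^n>0 2 ⌈log₂ 1 ⌉
  go n@(suc (suc n-2)) rec = begin
    n                                ≤⟨ n≤2*⌈n/2⌉ n ⟩
    2 * ⌈ n /2⌉                      ≤⟨ *-monoʳ-≤ 2 (rec (⌈n/2⌉<n n-2)) ⟩
    2 * 2 ^ ⌈log₂ ⌈ n /2⌉ ⌉          ≡⟨ cong (λ d → 2 ^ suc d) (⌈log₂⌈n/2⌉⌉≡⌈log₂n⌉∸1 n) ⟩
    2 ^ (1 + (⌈log₂ n ⌉ ∸ 1))        ≡⟨ cong (2 ^_) (m+[n∸m]≡n 1≤log) ⟩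
    2 ^ ⌈log₂ n ⌉                    ∎
    where
    open ≤-Reasoning
    1≤log : 1 ≤ ⌈log₂ n ⌉
    1≤log = ⌈log₂⌉-mono-≤ {2} {n} (s≤s (s≤s z≤n))

n≤2^m⇒⌈log₂n⌉≤m : ∀ {n m} → n ≤ 2 ^ m → ⌈log₂ n ⌉ ≤ m
n≤2^m⇒⌈log₂n⌉≤m {m = m} n≤ = ≤-trans (⌈log₂⌉-mono-≤ n≤) (≤-reflexive (⌈log₂2^n⌉≡n m))

-- Minimality of the ceiling: if the logarithm is `suc d` and `2 ^ d` were already at least `n`, the
-- logarithm would be at most `d`.
2^⌈log₂n⌉≤2*n : ∀ n → 1 ≤ n → 2 ^ ⌈log₂ n ⌉ ≤ 2 * n
2^⌈log₂n⌉≤2*n n 1≤n with ⌈log₂ n ⌉ in eq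
... | zero  = ≤-trans 1≤n (m≤m+n n _)
... | suc d with ≤-total (2 ^ d) n
...   | inj₁ 2^d≤n = *-monoʳ-≤ 2 2^d≤n
...   | inj₂ n≤2^d = contradiction (n≤2^m⇒⌈log₂n⌉≤m n≤2^d) (subst (_≰ d) (sym eq) 1+n≰n)

1≤n⇒1≤n^m : ∀ {n} m → 1 ≤ n → 1 ≤ n ^ m
1≤n⇒1≤n^m {suc n} m _ = m^n>0 (suc n) m

-- ∑ᵢ≤ₘ C(n,i), the number of leaves of the recursion tree of choose.
leaves : ℕ → ℕ → ℕ
leaves zero    n       = 1
leaves (suc m) zero    = 1
leaves (suc m) (suc n) = leaves m n + leaves (suc m) n

-- The summand 1 is attained, as `leaves 1 n` equals `n + 1`. The induction closes by
-- `1 + n ^ m ≤ (1 + n) ^ m`, which fails for exponent 0 and so forces the separate clause for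
-- `leaves 1`.
leaves≤1+n^m : ∀ m n → leaves m n ≤ 1 + n ^ m
leaves≤1+n^m zero          n       = s≤s z≤n
leaves≤1+n^m (suc m)       zero    = s≤s z≤n
leaves≤1+n^m (suc zero)    (suc n) = s≤s (leaves≤1+n^m 1 n)
leaves≤1+n^m (suc m@(suc _)) (suc n) = begin
  leaves m n + leaves (suc m) n            ≤⟨ +-mono-≤ (leaves≤1+n^m m n) (leaves≤1+n^m (suc m) n) ⟩
  (1 + n ^ m) + (1 + n * n ^ m)            ≡⟨ regroup n (n ^ m) ⟩
  1 + (1 + suc n * n ^ m)                  ≤⟨ s≤s (+-monoˡ-≤ (suc n * n ^ m) (m≤m*n 1 (suc n))) ⟩
  1 + (1 * suc n + suc n * n ^ m)          ≡⟨ cong suc (factor (suc n) (n ^ m)) ⟩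
  1 + suc n * (1 + n ^ m)                  ≤⟨ s≤s (*-monoʳ-≤ (suc n) (^-monoˡ-< m ≤-refl)) ⟩
  1 + suc n * suc n ^ m                    ∎
  where
  open ≤-Reasoning
  regroup : ∀ n x → (1 + x) + (1 + n * x) ≡ 1 + (1 + (1 + n) * x)
  regroup = solve-∀
  factor : ∀ n x → 1 * n + n * x ≡ n * (1 + x)
  factor = solve-∀

-- List primitives and merge sort: values and costs

lengthᵗ-value : ∀ {A : Set} (xs : List A) → value (lengthᵗ xs) ≡ length xs
lengthᵗ-value []       = refl
lengthᵗ-value (_ ∷ xs) = cong suc (lengthᵗ-value xs)

lengthᵗ-steps : ∀ {A : Set} (xs : List A) → steps (lengthᵗ xs) ≡ 1 + length xs
lengthᵗ-steps []       = refl
lengthᵗ-steps (_ ∷ xs) = trans (cong (_+ 1) (lengthᵗ-steps xs)) (+-comm _ 1)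

appendᵗ-value : ∀ {A : Set} (xs ys : List A) → value (appendᵗ xs ys) ≡ xs ++ ys
appendᵗ-value []       ys = refl
appendᵗ-value (x ∷ xs) ys = cong (x ∷_) (appendᵗ-value xs ys)

appendᵗ-steps : ∀ {A : Set} (xs ys : List A) → steps (appendᵗ xs ys) ≡ 1 + length xs
appendᵗ-steps []       ys = refl
appendᵗ-steps (x ∷ xs) ys = trans (cong (_+ 1) (appendᵗ-steps xs ys)) (+-comm _ 1)

module MergeSortProperties {A : Set} (_≤ᵗ_ : A → A → Timed Bool) where
  open MergeSort _≤ᵗ_

  merge-↭ : ∀ xs ys → value (merge xs ys) ↭ xs ++ ys
  merge-↭ []       ys       = ↭-refl
  merge-↭ (x ∷ xs) []       = ↭-reflexive (sym (++-identityʳ _))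
  merge-↭ (x ∷ xs) (y ∷ ys) with value (x ≤ᵗ y) | merge-↭ xs (y ∷ ys) | merge-↭ (x ∷ xs) ys
  ... | true  | ih | _  = prep x ih
  ... | false | _  | ih = ↭-trans (prep y ih) (↭-sym (Perm.shift y (x ∷ xs) ys))

  sortPrefix-↭ : ∀ d xs → (let ys , zs = value (sortPrefix d xs)) → ys ++ zs ↭ xs
  sortPrefix-↭ zero    []       = ↭-refl
  sortPrefix-↭ zero    (x ∷ xs) = ↭-refl
  sortPrefix-↭ (suc d) xs       = begin
    value (merge ys zs) ++ xs″  ↭⟨ Perm.++⁺ʳ xs″ (merge-↭ ys zs) ⟩
    (ys ++ zs) ++ xs″           ↭⟨ Perm.++-assoc ys zs xs″ ⟩
    ys ++ (zs ++ xs″)           ↭⟨ Perm.++⁺ˡ ys (sortPrefix-↭ d xs′) ⟩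
    ys ++ xs′                   ↭⟨ sortPrefix-↭ d xs ⟩
    xs                          ∎
    where
    open PermutationReasoning
    ys  = proj₁ (value (sortPrefix d xs))
    xs′ = proj₂ (value (sortPrefix d xs))
    zs  = proj₁ (value (sortPrefix d xs′))
    xs″ = proj₂ (value (sortPrefix d xs′))

  sortPrefix-rest : ∀ d xs → proj₂ (value (sortPrefix d xs)) ≡ drop (2 ^ d) xs
  sortPrefix-rest zero    []       = refl
  sortPrefix-rest zero    (x ∷ xs) = refl
  sortPrefix-rest (suc d) xs       = begin
    proj₂ (value (sortPrefix d (proj₂ (value (sortPrefix d xs)))))  ≡⟨ sortPrefix-rest d _ ⟩
    drop (2 ^ d) (proj₂ (value (sortPrefix d xs)))                  ≡⟨ cong (drop (2 ^ d)) (sortPrefix-rest d xs) ⟩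
    drop (2 ^ d) (drop (2 ^ d) xs)                                  ≡⟨ drop-drop (2 ^ d) (2 ^ d) xs ⟩
    drop (2 ^ d + 2 ^ d) xs                                         ≡⟨ cong (λ w → drop (2 ^ d + w) xs) (+-identityʳ (2 ^ d)) ⟨
    drop (2 ^ suc d) xs                                             ∎
    where
    open ≡-Reasoning

  -- `2 ^ ⌈log₂ l ⌉` is at least the length, so the remainder returned by `sortPrefix` is empty and
  -- discarding it loses nothing.
  sort-↭ : ∀ xs → value (sort xs) ↭ xs
  sort-↭ xs = ↭-trans (↭-reflexive (trans (sym (++-identityʳ _)) (cong (ys ++_) (sym rest≡[])))) (sortPrefix-↭ d xs)
    where
    d  = ⌈log₂ value (lengthᵗ xs) ⌉
    ys = proj₁ (value (sortPrefix d xs))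

    rest≡[] : proj₂ (value (sortPrefix d xs)) ≡ []
    rest≡[] = trans (sortPrefix-rest d xs)
      (drop-all _ xs (subst (λ l → length xs ≤ 2 ^ ⌈log₂ l ⌉) (sym (lengthᵗ-value xs)) (n≤2^⌈log₂n⌉ (length xs))))

  module _ {R : A → A → Set} (R-trans : ∀ {x y z} → R x y → R y z → R x z)
           (≤ᵗ-true : ∀ x y → value (x ≤ᵗ y) ≡ true → R x y)
           (≤ᵗ-false : ∀ x y → value (x ≤ᵗ y) ≡ false → R y x) where

    -- The new head is related to every element of both inputs, and `merge-↭` carries this over to
    -- the merged tail.
    merge-sorted : ∀ xs ys → AllPairs R xs → AllPairs R ys → AllPairs R (value (merge xs ys))
    merge-sorted []       ys       _          sys        = sys
    merge-sorted (x ∷ xs) []       sxs        _          = sxs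
    merge-sorted (x ∷ xs) (y ∷ ys) (rx ∷ sxs) (ry ∷ sys)
      with value (x ≤ᵗ y) in eq | merge-sorted xs (y ∷ ys) sxs (ry ∷ sys) | merge-sorted (x ∷ xs) ys (rx ∷ sxs) sys
    ... | true  | ih | _ = Perm.All-resp-↭ (↭-sym (merge-↭ xs (y ∷ ys)))
                             (All.++⁺ rx (x≤y ∷ All.map (R-trans x≤y) ry)) ∷ ih
      where x≤y = ≤ᵗ-true x y eq
    ... | false | _ | ih = Perm.All-resp-↭ (↭-sym (merge-↭ (x ∷ xs) ys))
                             (y≤x ∷ All.++⁺ (All.map (R-trans y≤x) rx) ry) ∷ ih
      where y≤x = ≤ᵗ-false x y eq

    sortPrefix-sorted : ∀ d xs → AllPairs R (proj₁ (value (sortPrefix d xs)))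
    sortPrefix-sorted zero    []       = []
    sortPrefix-sorted zero    (x ∷ xs) = [] ∷ []
    sortPrefix-sorted (suc d) xs       = merge-sorted _ _ (sortPrefix-sorted d xs) (sortPrefix-sorted d _)

    sort-sorted : ∀ xs → AllPairs R (value (sort xs))
    sort-sorted xs = sortPrefix-sorted ⌈log₂ value (lengthᵗ xs) ⌉ xs

  module _ (≤ᵗ-steps : ∀ x y → steps (x ≤ᵗ y) ≤ 1) where

    merge-steps : ∀ xs ys → steps (merge xs ys) ≤ 1 + 2 * (length xs + length ys)
    merge-steps []       ys       = s≤s z≤n
    merge-steps (x ∷ xs) []       = s≤s z≤n
    merge-steps (x ∷ xs) (y ∷ ys) with value (x ≤ᵗ y) | merge-steps xs (y ∷ ys) | merge-steps (x ∷ xs) ys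
    ... | true  | ih | _ = begin
      1 + (steps (x ≤ᵗ y) + (steps (merge xs (y ∷ ys)) + 0))        ≤⟨ s≤s (+-mono-≤ (≤ᵗ-steps x y) (+-monoˡ-≤ 0 ih)) ⟩
      1 + (1 + (1 + 2 * (length xs + suc (length ys)) + 0))         ≡⟨ regroup (length xs) (length ys) ⟩
      1 + 2 * (suc (length xs) + suc (length ys))                   ∎
      where
      open ≤-Reasoning
      regroup : ∀ a b → 1 + (1 + (1 + 2 * (a + (1 + b)) + 0)) ≡ 1 + 2 * ((1 + a) + (1 + b))
      regroup = solve-∀
    ... | false | _ | ih = begin
      1 + (steps (x ≤ᵗ y) + (steps (merge (x ∷ xs) ys) + 0))        ≤⟨ s≤s (+-mono-≤ (≤ᵗ-steps x y) (+-monoˡ-≤ 0 ih)) ⟩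
      1 + (1 + (1 + 2 * (suc (length xs) + length ys) + 0))         ≡⟨ regroup (length xs) (length ys) ⟩
      1 + 2 * (suc (length xs) + suc (length ys))                   ∎
      where
      open ≤-Reasoning
      regroup : ∀ a b → 1 + (1 + (1 + 2 * ((1 + a) + b) + 0)) ≡ 1 + 2 * ((1 + a) + (1 + b))
      regroup = solve-∀

    sortPrefix-length : ∀ d xs → length (proj₁ (value (sortPrefix d xs))) ≤ 2 ^ d
    sortPrefix-length zero    []       = z≤n
    sortPrefix-length zero    (x ∷ xs) = s≤s z≤n
    sortPrefix-length (suc d) xs       = begin
      length (value (merge ys zs))  ≡⟨ Perm.↭-length (merge-↭ ys zs) ⟩
      length (ys ++ zs)             ≡⟨ length-++ ys ⟩
      length ys + length zs         ≤⟨ +-mono-≤ (sortPrefix-length d xs) (sortPrefix-length d _) ⟩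
      2 ^ d + 2 ^ d                 ≡⟨ cong (2 ^ d +_) (+-identityʳ (2 ^ d)) ⟨
      2 ^ suc d                     ∎
      where
      open ≤-Reasoning
      ys = proj₁ (value (sortPrefix d xs))
      zs = proj₁ (value (sortPrefix d (proj₂ (value (sortPrefix d xs)))))

    -- The surplus 2 makes the recurrence homogeneous: the two halves supply 4, which is the 2
    -- required again plus the tick and the constant 1 of `merge-steps`. The linear part `4 * 2 ^ d`
    -- of merging raises the factor by 2 per level.
    sortPrefix-steps : ∀ d xs → 2 + steps (sortPrefix d xs) ≤ (3 + 2 * d) * 2 ^ d
    sortPrefix-steps zero    []       = ≤-refl
    sortPrefix-steps zero    (x ∷ xs) = ≤-refl
    sortPrefix-steps (suc d) xs       = begin
      2 + (1 + (s₁ + (s₂ + (steps (merge ys zs) + 0))))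
        ≤⟨ +-monoʳ-≤ 3 (+-monoʳ-≤ s₁ (+-monoʳ-≤ s₂ (+-monoˡ-≤ 0 merge≤))) ⟩
      2 + (1 + (s₁ + (s₂ + (1 + 2 * (2 ^ d + 2 ^ d) + 0))))
        ≡⟨ regroup s₁ s₂ (2 ^ d) ⟩
      (2 + s₁) + (2 + s₂) + 4 * 2 ^ d
        ≤⟨ +-monoˡ-≤ (4 * 2 ^ d) (+-mono-≤ (sortPrefix-steps d xs) (sortPrefix-steps d xs′)) ⟩
      (3 + 2 * d) * 2 ^ d + (3 + 2 * d) * 2 ^ d + 4 * 2 ^ d
        ≡⟨ factor d (2 ^ d) ⟩
      (3 + 2 * suc d) * 2 ^ suc d  ∎
      where
      open ≤-Reasoning
      ys  = proj₁ (value (sortPrefix d xs))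
      xs′ = proj₂ (value (sortPrefix d xs))
      zs  = proj₁ (value (sortPrefix d xs′))
      s₁  = steps (sortPrefix d xs)
      s₂  = steps (sortPrefix d xs′)
      merge≤ : steps (merge ys zs) ≤ 1 + 2 * (2 ^ d + 2 ^ d)
      merge≤ = ≤-trans (merge-steps ys zs)
        (s≤s (*-monoʳ-≤ 2 (+-mono-≤ (sortPrefix-length d xs) (sortPrefix-length d xs′))))
      regroup : ∀ s t w → 2 + (1 + (s + (t + (1 + 2 * (w + w) + 0)))) ≡ (2 + s) + (2 + t) + 4 * w
      regroup = solve-∀
      factor : ∀ d w → (3 + 2 * d) * w + (3 + 2 * d) * w + 4 * w ≡ (3 + 2 * (1 + d)) * (2 * w)
      factor = solve-∀

    sort-steps : ∀ xs {w e} → length xs ≤ w → 1 ≤ w → ⌈log₂ w ⌉ ≤ e →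
                 steps (sort xs) ≤ w + (3 + 2 * e) * (2 * w)
    sort-steps xs {w} {e} len≤w 1≤w log≤e = begin
      steps (lengthᵗ xs) + (1 + (steps (sortPrefix d xs) + 0))
        ≡⟨ cong (_+ (1 + (steps (sortPrefix d xs) + 0))) (lengthᵗ-steps xs) ⟩
      (1 + length xs) + (1 + (steps (sortPrefix d xs) + 0))
        ≡⟨ regroup (length xs) (steps (sortPrefix d xs)) ⟩
      length xs + (2 + steps (sortPrefix d xs))
        ≤⟨ +-mono-≤ len≤w (sortPrefix-steps d xs) ⟩
      w + (3 + 2 * d) * 2 ^ d
        ≤⟨ +-monoʳ-≤ w (*-mono-≤ (+-monoʳ-≤ 3 (*-monoʳ-≤ 2 (≤-trans d≤ log≤e)))
             (≤-trans (^-monoʳ-≤ 2 d≤) (2^⌈log₂n⌉≤2*n w 1≤w))) ⟩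
      w + (3 + 2 * e) * (2 * w)  ∎
      where
      open ≤-Reasoning
      d = ⌈log₂ value (lengthᵗ xs) ⌉
      d≤ : d ≤ ⌈log₂ w ⌉
      d≤ = ⌈log₂⌉-mono-≤ (≤-trans (≤-reflexive (lengthᵗ-value xs)) len≤w)
      regroup : ∀ l s → (1 + l) + (1 + (s + 0)) ≡ l + (2 + s)
      regroup = solve-∀

-- Ordered abelian groups

module OrderedGroupProperties (𝔾 : OrderedAbelianGroup) where
  open OrderedAbelianGroup 𝔾
    renaming (+-monoʳ-< to ⊕-monoʳ-≺; _<_ to _≺_; _+_ to _⊕_; -_ to ⊖_; _-_ to _⊝_; _<?_ to _≺?_)
  open IsStrictTotalOrder isStrictTotalOrder
    using (compare) renaming (trans to ≺-trans; irrefl to ≺-irrefl; asym to ≺-asym)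

  abelianGroup : AbelianGroup _ _
  abelianGroup = record { isAbelianGroup = isAbelianGroup }

  open AbelianGroup abelianGroup using (assoc; comm; identityˡ; identityʳ; inverseˡ; inverseʳ)
  open Algebra.Properties.AbelianGroup abelianGroup using (⁻¹-∙-comm; xyx⁻¹≈y)

  infix 4 _≼_
  -- The negated strict order is exactly what the Boolean `not y<x` computed by the comparison of
  -- entries expresses.
  _≼_ : Carrier → Carrier → Set
  x ≼ y = ¬ (y ≺ x)

  ≼-refl : ∀ {x} → x ≼ x
  ≼-refl = ≺-irrefl refl

  ≼-trans : ∀ {x y z} → x ≼ y → y ≼ z → x ≼ z
  ≼-trans {x} {y} {z} x≼y y≼z z≺x with compare y z
  ... | tri< y≺z _ _    = x≼y (≺-trans y≺z z≺x)
  ... | tri≈ _ refl _   = x≼y z≺x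
  ... | tri> _ _ z≺y    = y≼z z≺y

  ≺⇒≼ : ∀ {x y} → x ≺ y → x ≼ y
  ≺⇒≼ = ≺-asym

  ≼-≺-trans : ∀ {x y z} → x ≼ y → y ≺ z → x ≺ z
  ≼-≺-trans {x} {y} {z} x≼y y≺z with compare x y
  ... | tri< x≺y _ _  = ≺-trans x≺y y≺z
  ... | tri≈ _ refl _ = y≺z
  ... | tri> _ _ y≺x  = contradiction y≺x x≼y

  ≺-≼-trans : ∀ {x y z} → x ≺ y → y ≼ z → x ≺ z
  ≺-≼-trans {x} {y} {z} x≺y y≼z with compare y z
  ... | tri< y≺z _ _  = ≺-trans x≺y y≺z
  ... | tri≈ _ refl _ = x≺y
  ... | tri> _ _ z≺y  = contradiction z≺y y≼z

  ⊖x⊕[x⊕y]≡y : ∀ x y → ⊖ x ⊕ (x ⊕ y) ≡ y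
  ⊖x⊕[x⊕y]≡y x y = trans (sym (assoc _ _ _)) (trans (cong (_⊕ y) (inverseˡ x)) (identityˡ y))

  x⊕[y⊖x]≡y : ∀ x y → x ⊕ (y ⊝ x) ≡ y
  x⊕[y⊖x]≡y x y = trans (sym (assoc _ _ _)) (xyx⁻¹≈y x y)

  ⊖-antitone-≼ : ∀ {x y} → x ≼ y → ⊖ y ≼ ⊖ x
  ⊖-antitone-≼ {x} {y} x≼y ⊖x≺⊖y = x≼y (subst₂ _≺_
    (trans (comm _ _) (⊖x⊕[x⊕y]≡y x y))
    (trans (assoc x y (⊖ y)) (trans (cong (x ⊕_) (inverseʳ y)) (identityʳ x)))
    (⊕-monoʳ-≺ (x ⊕ y) ⊖x≺⊖y))

  ⊖x≺y⇒0≺x⊕y : ∀ {x y} → ⊖ x ≺ y → 0# ≺ x ⊕ y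
  ⊖x≺y⇒0≺x⊕y {x} {y} h = subst (_≺ x ⊕ y) (inverseʳ x) (⊕-monoʳ-≺ x h)

  0≺x⊕y⇒⊖x≺y : ∀ {x y} → 0# ≺ x ⊕ y → ⊖ x ≺ y
  0≺x⊕y⇒⊖x≺y {x} {y} h = subst₂ _≺_ (identityʳ _) (⊖x⊕[x⊕y]≡y x y) (⊕-monoʳ-≺ (⊖ x) h)

  y≺z⊝x⇒x⊕y≺z : ∀ {x y z} → y ≺ z ⊝ x → x ⊕ y ≺ z
  y≺z⊝x⇒x⊕y≺z {x} {y} {z} h = subst (x ⊕ y ≺_) (x⊕[y⊖x]≡y x z) (⊕-monoʳ-≺ x h)

  x⊕y≺z⇒y≺z⊝x : ∀ {x y z} → x ⊕ y ≺ z → y ≺ z ⊝ x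
  x⊕y≺z⇒y≺z⊝x {x} {y} {z} h = subst₂ _≺_ (⊖x⊕[x⊕y]≡y x y) (comm _ _) (⊕-monoʳ-≺ (⊖ x) h)

-- Array positions, counting below a threshold, and splits

module _ {A : Set} where

  at-≥length : ∀ (xs : List A) i → length xs ≤ i → at xs i ≡ nothing
  at-≥length []       _       _       = refl
  at-≥length (_ ∷ xs) (suc i) (s≤s p) = at-≥length xs i p

  at⇒∈ : ∀ (xs : List A) i {x} → at xs i ≡ just x → x ∈ xs
  at⇒∈ (_ ∷ _)  zero    refl = here refl
  at⇒∈ (_ ∷ xs) (suc i) eq   = there (at⇒∈ xs i eq)

  ∈⇒at : ∀ {xs : List A} {x} → x ∈ xs → ∃ λ i → at xs i ≡ just x
  ∈⇒at (here refl)  = zero , refl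
  ∈⇒at (there x∈xs) with i , eq ← ∈⇒at x∈xs = suc i , eq

  at-AllPairs : ∀ {R : A → A → Set} → (∀ {x} → R x x) → ∀ {xs i j y} → AllPairs R xs →
                i ≤ j → at xs j ≡ just y → ∃ λ x → at xs i ≡ just x × R x y
  at-AllPairs R-refl {_ ∷ _}  {zero}  {zero}  _          _         refl = _ , refl , R-refl
  at-AllPairs R-refl {_ ∷ xs} {zero}  {suc j} (r ∷ _)    _         eq   = _ , refl , All.lookup r (at⇒∈ xs j eq)
  at-AllPairs R-refl {_ ∷ xs} {suc i} {suc j} (_ ∷ rs)   (s≤s i≤j) eq   = at-AllPairs R-refl rs i≤j eq

n<2^n : ∀ n → n < 2 ^ n
n<2^n zero    = s≤s z≤n
n<2^n (suc n) = begin
  1 + suc n      ≤⟨ s≤s (n<2^n n) ⟩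
  1 + 2 ^ n      ≤⟨ +-mono-≤ (m^n>0 2 n) (m≤m+n (2 ^ n) 0) ⟩
  2 ^ suc n      ∎
  where open ≤-Reasoning

suc-pred[m+2^d] : ∀ m d → suc (pred (m + 2 ^ d)) ≡ m + 2 ^ d
suc-pred[m+2^d] m d = suc-pred (m + 2 ^ d) {{>-nonZero (≤-trans (m^n>0 2 d) (m≤n+m (2 ^ d) m))}}

AllPairs-resp-⊆ : ∀ {A : Set} {R : A → A → Set} {xs ys} → xs ⊆ ys → AllPairs R ys → AllPairs R xs
AllPairs-resp-⊆ []             []       = []
AllPairs-resp-⊆ (_ ∷ʳ xs⊆)     (_ ∷ rs) = AllPairs-resp-⊆ xs⊆ rs
AllPairs-resp-⊆ (refl ∷ xs⊆)   (r ∷ rs) = All-resp-⊆ xs⊆ r ∷ AllPairs-resp-⊆ xs⊆ rs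

module _ {A : Set} {P : A → Set} (P? : Decidable P) where

  length-filter-∁ : ∀ xs → length (filter P? xs) + length (filter (∁? P?) xs) ≡ length xs
  length-filter-∁ []       = refl
  length-filter-∁ (x ∷ xs) with P? x
  ... | yes _ = cong suc (length-filter-∁ xs)
  ... | no  _ = trans (+-suc _ _) (cong suc (length-filter-∁ xs))

  length-filter-mono : ∀ {Q : A → Set} (Q? : Decidable Q) {xs} → All (λ x → P x → Q x) xs →
                       length (filter P? xs) ≤ length (filter Q? xs)
  length-filter-mono Q? []                   = z≤n
  length-filter-mono Q? (_∷_ {x} P⇒Q P⇒Qs) with P? x | Q? x
  ... | yes _ | yes _  = s≤s (length-filter-mono Q? P⇒Qs)
  ... | yes p | no ¬q  = contradiction (P⇒Q p) ¬q
  ... | no  _ | yes _  = m≤n⇒m≤1+n (length-filter-mono Q? P⇒Qs)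
  ... | no  _ | no _   = length-filter-mono Q? P⇒Qs

  -- After the first element in `P` but not in `Q`, the pairwise hypothesis gives `P` implies `Q`
  -- for all later ones, so the surplus is at most one.
  length-filter-suc : ∀ {Q : A → Set} (Q? : Decidable Q) {xs} → AllPairs (λ x y → P x → ¬ Q x → P y → Q y) xs →
                      length (filter P? xs) ≤ suc (length (filter Q? xs))
  length-filter-suc Q? []             = z≤n
  length-filter-suc Q? (_∷_ {x} r rs) with P? x | Q? x
  ... | yes _  | yes _ = s≤s (length-filter-suc Q? rs)
  ... | yes p  | no ¬q = s≤s (length-filter-mono Q? (All.map (λ r → r p ¬q) r))
  ... | no  _  | yes _ = m≤n⇒m≤1+n (length-filter-suc Q? rs)
  ... | no  _  | no _  = length-filter-suc Q? rs

module _ {A : Set} (h : A → ℕ) where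

  count< : ℕ → List A → ℕ
  count< t xs = length (filter (λ x → h x <? t) xs)

  -- Newly counted elements have value exactly `t`, and distinct values leave room for only one of
  -- them.
  count<-suc : ∀ t {xs} → AllPairs (λ x y → h x ≢ h y) xs → count< (suc t) xs ≤ suc (count< t xs)
  count<-suc t inj = length-filter-suc (λ x → h x <? suc t) (λ x → h x <? t) (AllPairs.map
    (λ hx≢hy hx<1+t hx≮t hy<1+t → ≤∧≢⇒< (s≤s⁻¹ hy<1+t)
      (λ hy≡t → hx≢hy (trans (≤-antisym (s≤s⁻¹ hx<1+t) (≮⇒≥ hx≮t)) (sym hy≡t)))) inj)

  -- The count grows by at most one with the threshold, so it takes every intermediate value.
  count<-intermediate : ∀ {xs} → AllPairs (λ x y → h x ≢ h y) xs → ∀ l {m} → m ≤ count< l xs →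
                        ∃ λ t → t ≤ l × count< t xs ≡ m
  count<-intermediate {xs} inj zero    m≤ = 0 , z≤n , ≤-antisym
    (≤-trans (≤-reflexive (cong length (filter-none (λ x → h x <? 0) {xs} (All.tabulate λ _ ())))) z≤n) m≤
  count<-intermediate {xs} inj (suc l) {m} m≤ with m ≟ count< (suc l) xs
  ... | yes m≡ = suc l , ≤-refl , sym m≡
  ... | no  m≢ with t , t≤l , eq ← count<-intermediate inj l (s≤s⁻¹ (≤-trans (≤∧≢⇒< m≤ m≢) (count<-suc l inj))) =
    t , m≤n⇒m≤1+n t≤l , eq

count<-all : ∀ {A : Set} {l} (h : A → Fin l) xs → count< (toℕ ∘ h) l xs ≡ length xs
count<-all {l = l} h xs = cong length (filter-all (λ x → toℕ (h x) <? l) {xs} (All.tabulate λ {x} _ → toℕ<n (h x)))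

-- A cut at `l` would count the whole list, so `m < length xs` forces the cut below `l`, where it is
-- an element of `Fin l` and hence one of the thresholds in `twoColourings`.
threshold : ∀ {A : Set} {l} (h : A → Fin l) {xs} → AllPairs (λ x y → h x ≢ h y) xs → ∀ {m} → m < length xs →
            ∃ λ (t : Fin l) → length (filter (λ x → h x Fin.<? t) xs) ≡ m
threshold {l = l} h {xs} inj {m} m<
  with t , t≤l , eq ← count<-intermediate (toℕ ∘ h) (AllPairs.map (_∘ toℕ-injective) inj) l
                        (≤-trans (<⇒≤ m<) (≤-reflexive (sym (count<-all h xs))))
  with t ≟ l
... | yes refl = contradiction (trans (sym eq) (count<-all h xs)) (<⇒≢ m<)
... | no  t≢l  = fromℕ< t<l , trans (cong (λ t → count< (toℕ ∘ h) t xs) (toℕ-fromℕ< t<l)) eq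
  where t<l = ≤∧≢⇒< t≤l t≢l

length-cartesianProductWith : ∀ {A B C : Set} (f : A → B → C) xs ys →
                              length (cartesianProductWith f xs ys) ≡ length xs * length ys
length-cartesianProductWith f []       ys = refl
length-cartesianProductWith f (x ∷ xs) ys = trans (length-++ (map (f x) ys))
  (cong₂ _+_ (length-map (f x) ys) (length-cartesianProductWith f xs ys))

splits-length : ∀ {n l} (H : List (Fin n → Fin l)) → length (splits H) ≡ length H * (l + l)
splits-length {l = l} H = trans (length-cartesianProductWith _ H (twoColourings l)) (cong (length H *_)
  (trans (length-++ (map below (allFin l))) (cong₂ _+_ (map-allFin below) (map-allFin _))))
  where
  map-allFin : ∀ (f : Fin l → Fin l → Fin 2) → length (map f (allFin l)) ≡ l
  map-allFin f = trans (length-map f (allFin l)) (length-tabulate id)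

below∈splits : ∀ {n l} {H : List (Fin n → Fin l)} {h} t → h ∈ H → below t ∘ h ∈ splits H
below∈splits t h∈H = ∈-cartesianProductWith⁺ _ h∈H (∈-++⁺ˡ (∈-map⁺ below (∈-allFin t)))

-- Makes the larger half a proper part of the `k` jobs, as `threshold` demands; for a single job it
-- would not be.
⌈k/2⌉<k : ∀ {k} → 2 ≤ k → ⌈ k /2⌉ < k
⌈k/2⌉<k (s≤s (s≤s _)) = ⌈n/2⌉<n _

map-just⁻ : ∀ {A B : Set} {f : A → B} m {y} → Maybe.map f m ≡ just y → ∃ λ x → m ≡ just x × f x ≡ y
map-just⁻ (just x) refl = x , refl , refl

maybe-≤ : ∀ {A : Set} {f : A → ℕ} {b} m → (∀ {x} → m ≡ just x → f x ≤ b) → maybe f 0 m ≤ b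
maybe-≤ nothing  _ = z≤n
maybe-≤ (just x) h = h refl

AllPairs-injective : ∀ {A B : Set} {h : A → B} {xs} → (∀ {i j} → i ∈ xs → j ∈ xs → h i ≡ h j → i ≡ j) →
                     Unique xs → AllPairs (λ x y → h x ≢ h y) xs
AllPairs-injective inj []         = []
AllPairs-injective inj (x≢ ∷ uniq) =
  All.tabulate (λ y∈ hx≡hy → All.lookup x≢ y∈ (inj (here refl) (there y∈) hx≡hy))
  ∷ AllPairs-injective (λ i∈ j∈ → inj (there i∈) (there j∈)) uniq

-- The left side lists the costs in the order of `derandomizedSwap`: two loads, comparison and
-- difference, `choose` and sorting twice, all runs, `separate`. Everything but the runs is at most
-- a multiple of `Y = k * ℓ * w`; the runs alone account for `k ^ 9`.
total-bound : ∀ k n x ℓ κ h a {w e} → w ≡ 2 * x → e ≡ 1 + k * ℓ →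
  1 ≤ k → 1 ≤ ℓ → 1 ≤ κ → 1 ≤ x → n ≤ x → h ≤ a * (k ^ 6 * κ * ℓ) →
  (1 + 5 * n) + ((1 + 5 * n) + (1 + (1 +
    ((8 + 3 * k) * w + ((w + (3 + 2 * e) * (2 * w)) + ((8 + 3 * k) * w + ((w + (3 + 2 * e) * (2 * w)) +
      ((1 + h * (k ^ 2 + k ^ 2) * (1 + (26 + 9 * k) * w)) + (1 + 3 * k)))))))))
  ≤ (142 + 144 * a) * (k ^ 9 * x * ℓ * κ)
total-bound k n x ℓ κ h a {w} refl refl 1≤k 1≤ℓ 1≤κ 1≤x n≤x h≤ = begin
  _
    ≡⟨ regroup n k ℓ w (h * (k ^ 2 + k ^ 2) * (1 + (26 + 9 * k) * w)) ⟩
  10 * n + 6 * 1 + 3 * k + 38 * w + 6 * (k * w) + 8 * (k * ℓ * w) + h * (k ^ 2 + k ^ 2) * (1 * 1 + (26 + 9 * k) * w)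
    ≤⟨ +-mono-≤
         (+-monoˡ-≤ (8 * Y) (+-mono-≤ (+-mono-≤ (+-mono-≤ (+-mono-≤
           (*-monoʳ-≤ 10 (≤-trans n≤x (≤-trans x≤w w≤Y)))
           (*-monoʳ-≤ 6 (≤-trans 1≤w w≤Y)))
           (*-monoʳ-≤ 3 k≤Y))
           (*-monoʳ-≤ 38 w≤Y))
           (*-monoʳ-≤ 6 kw≤Y)))
         (*-mono-≤ (*-monoˡ-≤ (k ^ 2 + k ^ 2) h≤)
           (+-mono-≤ (*-mono-≤ 1≤k 1≤w) (*-monoˡ-≤ w (+-monoˡ-≤ (9 * k) (*-monoʳ-≤ 26 1≤k))))) ⟩
  10 * Y + 6 * Y + 3 * Y + 38 * Y + 6 * Y + 8 * Y
    + a * (k ^ 6 * κ * ℓ) * (k ^ 2 + k ^ 2) * (k * w + (26 * k + 9 * k) * w)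
    -- `142 = 2 * (10 + 6 + 3 + 38 + 6 + 8)`, doubled because `w ≡ 2 * x`. `144 = 2 * 36 * 2`: the
    -- `2k²` colourings per hash function, the `1 + 26 + 9` units of `k * w` per run, and again
    -- `w ≡ 2 * x`. The two factors 1 hold the places of `k ^ 8` and `κ`.
    ≡⟨ regroup′ k x ℓ κ a (k ^ 6) ⟩
  142 * (1 * (k * x * ℓ * 1)) + 144 * a * (k ^ 9 * x * ℓ * κ)
    ≤⟨ +-monoˡ-≤ (144 * a * (k ^ 9 * x * ℓ * κ)) (*-monoʳ-≤ 142 (*-mono-≤ 1≤k^8 (*-monoʳ-≤ (k * x * ℓ) 1≤κ))) ⟩
  142 * (k ^ 8 * (k * x * ℓ * κ)) + 144 * a * (k ^ 9 * x * ℓ * κ)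
    ≡⟨ factor k x ℓ κ a (k ^ 6) ⟩
  (142 + 144 * a) * (k ^ 9 * x * ℓ * κ) ∎
  where
  open ≤-Reasoning
  Y = k * ℓ * w
  x≤w : x ≤ w
  x≤w = m≤m+n x _
  1≤w : 1 ≤ w
  1≤w = ≤-trans 1≤x x≤w
  1≤kℓ : 1 ≤ k * ℓ
  1≤kℓ = *-mono-≤ 1≤k 1≤ℓ
  w≤Y : w ≤ Y
  w≤Y = ≤-trans (≤-reflexive (sym (*-identityˡ w))) (*-monoˡ-≤ w 1≤kℓ)
  kw≤Y : k * w ≤ Y
  kw≤Y = *-monoˡ-≤ w (≤-trans (≤-reflexive (sym (*-identityʳ k))) (*-monoʳ-≤ k 1≤ℓ))
  k≤Y : k ≤ Y
  k≤Y = ≤-trans (≤-trans (≤-reflexive (sym (*-identityʳ k))) (*-monoʳ-≤ k 1≤w)) kw≤Y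
  1≤k^8 : 1 ≤ k ^ 8
  1≤k^8 = ^-monoˡ-≤ 8 1≤k
  regroup : ∀ n k ℓ w r →
    (1 + 5 * n) + ((1 + 5 * n) + (1 + (1 +
      ((8 + 3 * k) * w + ((w + (3 + 2 * (1 + k * ℓ)) * (2 * w)) + ((8 + 3 * k) * w + ((w + (3 + 2 * (1 + k * ℓ)) * (2 * w)) +
        ((1 + r) + (1 + 3 * k)))))))))
    ≡ 10 * n + 6 * 1 + 3 * k + 38 * w + 6 * (k * w) + 8 * (k * ℓ * w) + r
  regroup = solve-∀
  -- `q` stands for `k ^ 6`, over which `k ^ 9` unfolds to three more factors `k`; this keeps the
  -- polynomials small.
  regroup′ : ∀ k x ℓ κ a q → (let Y = k * ℓ * (2 * x)) →
    10 * Y + 6 * Y + 3 * Y + 38 * Y + 6 * Y + 8 * Y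
      + a * (q * κ * ℓ) * (k * (k * 1) + k * (k * 1)) * (k * (2 * x) + (26 * k + 9 * k) * (2 * x))
    ≡ 142 * (1 * (k * x * ℓ * 1)) + 144 * a * (k * (k * (k * q)) * x * ℓ * κ)
  regroup′ = solve-∀
  factor : ∀ k x ℓ κ a q → 142 * (k * (k * q) * (k * x * ℓ * κ)) + 144 * a * (k * (k * (k * q)) * x * ℓ * κ)
                           ≡ (142 + 144 * a) * (k * (k * (k * q)) * x * ℓ * κ)
  factor = solve-∀

module SwapProperties (𝔾 : OrderedAbelianGroup) {n : ℕ}
                      (p : Fin n → OrderedAbelianGroup.Carrier 𝔾) (σ : Schedule n) where
  open OrderedAbelianGroup 𝔾 using (Carrier; 0#)
    renaming (_<_ to _≺_; _+_ to _⊕_; -_ to ⊖_; _-_ to _⊝_; _<?_ to _≺?_)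
  open OrderedGroupProperties 𝔾
  open AbelianGroup abelianGroup using (assoc; identityˡ; inverseʳ; commutativeSemigroup)
  open Algebra.Properties.CommutativeSemigroup commutativeSemigroup using (x∙yz≈y∙xz)
  open Algebra.Properties.AbelianGroup abelianGroup using (⁻¹-∙-comm)
  open TwoMachines 𝔾 p σ

  listSum : ∀ {A : Set} → (A → Carrier) → List A → Carrier
  listSum f = foldr (λ j x → f j ⊕ x) 0#

  -- The galloping search for one value

  module _ (B : List Entry) (z : Carrier) where
    open BinarySearch B z

    exceeds-nothing : ∀ i → at B i ≡ nothing → value (exceeds i) ≡ true
    exceeds-nothing i eq rewrite eq = refl

    exceeds-just : ∀ i {y S} → at B i ≡ just (y , S) → value (exceeds i) ≡ does (z ≺? y)
    exceeds-just i eq rewrite eq = refl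

    exceeds-false⇒< : ∀ i → value (exceeds i) ≡ false → i < length B
    exceeds-false⇒< i eq with i <? length B
    ... | yes i<l = i<l
    ... | no  i≮l = contradiction (trans (sym (exceeds-nothing i (at-≥length B i (≮⇒≥ i≮l)))) eq) λ ()

    exceeds-steps : ∀ i → steps (exceeds i) ≤ 2
    exceeds-steps i with at B i
    ... | nothing = s≤s z≤n
    ... | just _  = ≤-refl

    bisect-exceeds : ∀ d lo → value (exceeds (pred (lo + 2 ^ d))) ≡ true →
                     value (exceeds (value (bisect d lo))) ≡ true
    bisect-exceeds zero    lo exc = subst (λ i → value (exceeds i) ≡ true) (cong pred (+-comm lo 1)) exc
    bisect-exceeds (suc d) lo exc with value (exceeds (pred (lo + 2 ^ d))) in eq
    ... | true  = bisect-exceeds d lo eq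
    ... | false = bisect-exceeds d (lo + 2 ^ d)
      (subst (λ i → value (exceeds (pred i)) ≡ true) (double lo (2 ^ d)) exc)
      where
      double : ∀ lo w → lo + 2 * w ≡ (lo + w) + w
      double = solve-∀

    -- The hypothesis is a subtraction-free form of a geometric sum: the remaining `f` doublings
    -- have widths `2 ^ d` up to `2 ^ (d + f - 1)`, in total `2 ^ (d + f) - 2 ^ d`, and together
    -- they reach the end of `B`.
    locate-exceeds : ∀ f d lo → length B + 2 ^ d ≤ lo + 2 ^ (d + f) →
                     value (exceeds (value (locate f d lo))) ≡ true
    locate-exceeds zero    d lo fuel = exceeds-nothing lo (at-≥length B lo (+-cancelʳ-≤ (2 ^ d) _ _
      (subst (λ e → length B + 2 ^ d ≤ lo + 2 ^ e) (+-identityʳ d) fuel)))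
    locate-exceeds (suc f) d lo fuel with value (exceeds (pred (lo + 2 ^ d))) in eq
    ... | true  = bisect-exceeds d lo eq
    ... | false = locate-exceeds f (suc d) (lo + 2 ^ d) (begin
      length B + 2 * 2 ^ d            ≡⟨ regroup (length B) (2 ^ d) ⟩
      (length B + 2 ^ d) + 2 ^ d      ≤⟨ +-monoˡ-≤ (2 ^ d) fuel ⟩
      (lo + 2 ^ (d + suc f)) + 2 ^ d  ≡⟨ cong (λ e → (lo + 2 ^ e) + 2 ^ d) (+-suc d f) ⟩
      (lo + 2 ^ suc (d + f)) + 2 ^ d  ≡⟨ regroup′ lo (2 ^ suc (d + f)) (2 ^ d) ⟩
      (lo + 2 ^ d) + 2 ^ suc (d + f)  ∎)
      where
      open ≤-Reasoning
      regroup : ∀ l w → l + 2 * w ≡ (l + w) + w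
      regroup = solve-∀
      regroup′ : ∀ l v w → (l + v) + w ≡ (l + w) + v
      regroup′ = solve-∀

    module _ {Inv : ℕ → Set} (inv-suc : ∀ i → value (exceeds i) ≡ false → Inv (suc i)) where

      inv-jump : ∀ d lo → value (exceeds (pred (lo + 2 ^ d))) ≡ false → Inv (lo + 2 ^ d)
      inv-jump d lo eq = subst Inv (suc-pred[m+2^d] lo d) (inv-suc _ eq)

      -- The position only ever moves to one right after a tested entry that does not exceed `z`, so
      -- `inv-suc` is all that is needed. Used both for staying within `B` and for `Passed`.
      bisect-invariant : ∀ d lo → Inv lo → Inv (value (bisect d lo))
      bisect-invariant zero    lo inv = inv
      bisect-invariant (suc d) lo inv with value (exceeds (pred (lo + 2 ^ d))) in eq
      ... | true  = bisect-invariant d lo inv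
      ... | false = bisect-invariant d (lo + 2 ^ d) (inv-jump d lo eq)

      locate-invariant : ∀ f d lo → Inv lo → Inv (value (locate f d lo))
      locate-invariant zero    d lo inv = inv
      locate-invariant (suc f) d lo inv with value (exceeds (pred (lo + 2 ^ d))) in eq
      ... | true  = bisect-invariant d lo inv
      ... | false = locate-invariant f (suc d) (lo + 2 ^ d) (inv-jump d lo eq)

    locate-≤length : ∀ f d lo → lo ≤ length B → value (locate f d lo) ≤ length B
    locate-≤length = locate-invariant exceeds-false⇒<

    bisect-≥ : ∀ d lo → lo ≤ value (bisect d lo)
    bisect-≥ zero    lo = ≤-refl
    bisect-≥ (suc d) lo with value (exceeds (pred (lo + 2 ^ d)))
    ... | true  = bisect-≥ d lo
    ... | false = ≤-trans (m≤m+n lo _) (bisect-≥ d (lo + 2 ^ d))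

    -- Each level costs two arithmetic operations and at most two steps for `exceeds`.
    bisect-steps : ∀ d lo → steps (bisect d lo) ≤ 1 + 4 * d
    bisect-steps zero    lo = ≤-refl
    bisect-steps (suc d) lo = ≤-trans (s≤s (s≤s (+-mono-≤ (exceeds-steps (pred (lo + 2 ^ d))) halves)))
                                    (≤-reflexive (regroup d))
      where
      halves : steps (if value (exceeds (pred (lo + 2 ^ d))) then bisect d lo else bisect d (lo + 2 ^ d)) ≤ 1 + 4 * d
      halves with value (exceeds (pred (lo + 2 ^ d)))
      ... | true  = bisect-steps d lo
      ... | false = bisect-steps d (lo + 2 ^ d)
      regroup : ∀ d → 1 + (1 + (2 + (1 + 4 * d))) ≡ 1 + 4 * (1 + d)
      regroup = solve-∀

    -- The logarithmic cost of a galloping search is charged to the distance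
    -- covered, so that the searches of one run telescope to a linear bound.
    locate-steps : ∀ f d lo → steps (locate f d lo) + 8 * lo ≤ 8 * value (locate f d lo) + (5 + 4 * d)
    locate-steps zero    d lo = ≤-trans (m≤m+n _ (4 + 4 * d)) (≤-reflexive (regroup lo d))
      where
      regroup : ∀ l d → 1 + 8 * l + (4 + 4 * d) ≡ 8 * l + (5 + 4 * d)
      regroup = solve-∀
    locate-steps (suc f) d lo with value (exceeds (pred (lo + 2 ^ d)))
    ... | true  = begin
      1 + (1 + (steps (exceeds hi-1) + steps (bisect d lo))) + 8 * lo
        ≤⟨ +-mono-≤ (s≤s (s≤s (+-mono-≤ (exceeds-steps hi-1) (bisect-steps d lo)))) (*-monoʳ-≤ 8 (bisect-≥ d lo)) ⟩
      1 + (1 + (2 + (1 + 4 * d))) + 8 * value (bisect d lo)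
        ≡⟨ +-comm (5 + 4 * d) _ ⟩
      8 * value (bisect d lo) + (5 + 4 * d) ∎
      where
      open ≤-Reasoning
      hi-1 = pred (lo + 2 ^ d)
    ... | false = begin
      1 + (1 + (steps (exceeds hi-1) + steps (locate f (suc d) (lo + 2 ^ d)))) + 8 * lo
        ≤⟨ +-monoˡ-≤ (8 * lo) (s≤s (s≤s (+-monoˡ-≤ _ (exceeds-steps hi-1)))) ⟩
      1 + (1 + (2 + steps (locate f (suc d) (lo + 2 ^ d)))) + 8 * lo
        ≡⟨ regroup (steps (locate f (suc d) (lo + 2 ^ d))) lo ⟩
      steps (locate f (suc d) (lo + 2 ^ d)) + 8 * lo + 4
        ≤⟨ +-cancelʳ-≤ (8 * 2 ^ d) _ _ (begin
          s + 8 * lo + 4 + 8 * 2 ^ d           ≡⟨ regroup′ s lo (2 ^ d) ⟩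
          s + 8 * (lo + 2 ^ d) + 4             ≤⟨ +-monoˡ-≤ 4 (locate-steps f (suc d) (lo + 2 ^ d)) ⟩
          8 * v + (5 + 4 * suc d) + 4          ≡⟨ regroup″ v d ⟩
          8 * v + (5 + 4 * d) + 8 * 1          ≤⟨ +-monoʳ-≤ (8 * v + (5 + 4 * d)) (*-monoʳ-≤ 8 (m^n>0 2 d)) ⟩
          8 * v + (5 + 4 * d) + 8 * 2 ^ d      ∎) ⟩
      8 * v + (5 + 4 * d) ∎
      where
      open ≤-Reasoning
      hi-1 = pred (lo + 2 ^ d)
      s = steps (locate f (suc d) (lo + 2 ^ d))
      v = value (locate f (suc d) (lo + 2 ^ d))
      regroup : ∀ s l → 1 + (1 + (2 + s)) + 8 * l ≡ s + 8 * l + 4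
      regroup = solve-∀
      regroup′ : ∀ s l w → s + 8 * l + 4 + 8 * w ≡ s + 8 * (l + w) + 4
      regroup′ = solve-∀
      regroup″ : ∀ v d → 8 * v + (5 + 4 * (1 + d)) + 4 ≡ 8 * v + (5 + 4 * d) + 8 * 1
      regroup″ = solve-∀

  -- `length B` doublings are enough because `length B < 2 ^ length B`; this justifies the fuel that
  -- `run` passes on.
  locate-finds : ∀ B z lo → value (BinarySearch.exceeds B z (value (BinarySearch.locate B z (length B) 0 lo))) ≡ true
  locate-finds B z lo = locate-exceeds B z (length B) 0 lo (begin
    length B + 1        ≡⟨ +-comm _ 1 ⟩
    suc (length B)      ≤⟨ n<2^n (length B) ⟩
    2 ^ length B        ≤⟨ m≤n+m _ lo ⟩
    lo + 2 ^ length B   ∎)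
    where open ≤-Reasoning

  -- Searching for all x in one run

  Hit : Carrier → Entry → Entry → Set
  Hit δ (x , _) (y , _) = 0# ≺ x ⊕ y × x ⊕ y ≺ δ

  does-true : ∀ {P : Set} (P? : Dec P) → does P? ≡ true → P
  does-true (yes p) _ = p

  does-false : ∀ {P : Set} (P? : Dec P) → does P? ≡ false → ¬ P
  does-false (no ¬p) _ = ¬p

  -- The algorithm tests only the upper bound on y; the lower bound `-x < y` comes from
  -- `locate-finds`, which ensures that the position returned exceeds `-x`.
  search-sound : ∀ δ B as lo {S} → value (search δ B (length B) as lo) ≡ just S →
                 ∃₂ λ e e′ → e ∈ as × e′ ∈ B × Hit δ e e′ × S ≡ proj₂ e ++ proj₂ e′
  search-sound δ B ((x , S₁) ∷ as) lo found
    with value (BinarySearch.locate B (⊖ x) (length B) 0 lo) | locate-finds B (⊖ x) lo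
  ... | i | exc with at B i in eq
  ...   | nothing with e , e′ , e∈as , rest ← search-sound δ B as i found = e , e′ , there e∈as , rest
  ...   | just (y , S₂) with y ≺? (δ ⊝ x)
  ...     | no  _ with e , e′ , e∈as , rest ← search-sound δ B as i found = e , e′ , there e∈as , rest
  ...     | yes y≺δ-x with refl ← found =
    _ , _ , here refl , at⇒∈ B i eq
      , (⊖x≺y⇒0≺x⊕y (does-true (⊖ x ≺? y) exc) , y≺z⊝x⇒x⊕y≺z y≺δ-x)
      , appendᵗ-value S₁ S₂

  _≤ₑ_ _≥ₑ_ : Entry → Entry → Set
  (x , _) ≤ₑ (y , _) = x ≼ y
  e ≥ₑ e′ = e′ ≤ₑ e

  -- Since `exceeds` is true past the end, this also says that all positions before `i` lie inside
  -- `B`, which rules out the `nothing` cases below.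
  Passed : List Entry → ℕ → Carrier → Set
  Passed B i x = ∀ j → j < i → value (BinarySearch.exceeds B (⊖ x) j) ≡ false

  passed-mono : ∀ {B i x x′} → x′ ≼ x → Passed B i x → Passed B i x′
  passed-mono {B} {x = x} {x′} x′≼x passed j j<i with at B j | passed j j<i
  ... | just (y , _) | exc with ⊖ x′ ≺? y
  ...   | no  _       = refl
  ...   | yes -x′≺y   = contradiction (≼-≺-trans (⊖-antitone-≼ x′≼x) -x′≺y) (does-false (⊖ x ≺? y) exc)

  passed-locate : ∀ {B lo x} → AllPairs _≤ₑ_ B → Passed B lo x → ∀ f →
                  Passed B (value (BinarySearch.locate B (⊖ x) f 0 lo)) x
  passed-locate {B} {lo} {x} sorted passed f =
    locate-invariant B (⊖ x) {Inv = λ i → Passed B i x} passed-suc f 0 lo passed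
    where
    passed-suc : ∀ i → value (BinarySearch.exceeds B (⊖ x) i) ≡ false → Passed B (suc i) x
    passed-suc i exc j (s≤s j≤i) with at B i in eq
    ... | just (y , _) with (y′ , _) , eq′ , y′≼y ← at-AllPairs {R = _≤ₑ_} ≼-refl sorted j≤i eq
      rewrite eq′ with ⊖ x ≺? y′
    ...   | no  _     = refl
    ...   | yes -x≺y′ = contradiction (≺-≼-trans -x≺y′ y′≼y) (does-false (⊖ x ≺? y) exc)

  -- A partner y of x satisfies `-x < y`, so it is not at a passed position; its index is at least
  -- `i`, and sortedness then supplies an entry at `i` that is no larger.
  passed-hit : ∀ {δ B i x S e′} → AllPairs _≤ₑ_ B → Passed B i x → e′ ∈ B → Hit δ (x , S) e′ →
               ∃ λ e″ → at B i ≡ just e″ × e″ ≤ₑ e′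
  passed-hit {B = B} {i} {x} {e′ = y , _} sorted passed e′∈B (0≺x⊕y , _) with j , at-j ← ∈⇒at e′∈B | i ≤? j
  ... | yes i≤j = at-AllPairs {R = _≤ₑ_} ≼-refl sorted i≤j at-j
  ... | no  i≰j = contradiction (0≺x⊕y⇒⊖x≺y 0≺x⊕y) (does-false (⊖ x ≺? y)
    (trans (sym (exceeds-just B (⊖ x) j at-j)) (passed j (≰⇒> i≰j))))

  pass-later : ∀ {B i e as} → All (e ≥ₑ_) as → Passed B i (proj₁ e) → All (λ e′ → Passed B i (proj₁ e′)) as
  pass-later {B} e≥ passed = All.map (λ e′≤e → passed-mono {B} e′≤e passed) e≥

  search-complete : ∀ δ B as lo → AllPairs _≤ₑ_ B → AllPairs _≥ₑ_ as → All (λ e → Passed B lo (proj₁ e)) as →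
                    ∀ {e e′} → e ∈ as → e′ ∈ B → Hit δ e e′ →
                    ∃ λ S → value (search δ B (length B) as lo) ≡ just S
  search-complete δ B ((x , S₁) ∷ as) lo B-sorted (x≥ ∷ as-sorted) (pass ∷ _) {e} {e′} e∈as e′∈B hit
    with value (BinarySearch.locate B (⊖ x) (length B) 0 lo) | passed-locate B-sorted pass (length B)
  ... | i | pass′ with at B i in eq | e∈as
  ...   | nothing       | there e∈as′ =
    search-complete δ B as i B-sorted as-sorted (pass-later {B} {e = x , S₁} x≥ pass′) e∈as′ e′∈B hit
  ...   | nothing       | here refl   =
    contradiction (trans (sym eq) (proj₁ (proj₂ (passed-hit {S = S₁} B-sorted pass′ e′∈B hit)))) λ ()
  ...   | just (y , S₂) | e∈x∷as with y ≺? (δ ⊝ x) | e∈x∷as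
  -- This success may belong to a pair other than `e` and `e′`.
  ...     | yes _  | _           = _ , refl
  ...     | no _   | there e∈as′ =
    search-complete δ B as i B-sorted as-sorted (pass-later {B} {e = x , S₁} x≥ pass′) e∈as′ e′∈B hit
  -- The entry at `i` is at most the assumed partner, so if it violates the upper bound, the partner
  -- does too.
  ...     | no y⊀  | here refl
    with _ , eq′ , y≼y₀ ← passed-hit {S = S₁} B-sorted pass′ e′∈B hit
    with refl ← trans (sym eq) eq′ =
    contradiction (≼-≺-trans y≼y₀ (x⊕y≺z⇒y≺z⊝x (proj₂ hit))) y⊀

  private
    -- One round of the amortisation. The 9 per entry is the 5 left over by `locate-steps` at
    -- `d = 0` plus 4 for the negation, the access to `B`, the subtraction and the comparison.
    bound : ∀ s lo i b a q c → s + 8 * lo ≤ 8 * i + 5 → c + 8 * i ≤ 8 * b + 9 * a + q →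
            1 + (s + (1 + (1 + (1 + c)))) + 8 * lo ≤ 8 * b + 9 * (1 + a) + q
    bound s lo i b a q c s≤ c≤ = begin
      1 + (s + (1 + (1 + (1 + c)))) + 8 * lo    ≡⟨ regroup s c lo ⟩
      (s + 8 * lo) + (4 + c)                    ≤⟨ +-monoˡ-≤ (4 + c) s≤ ⟩
      (8 * i + 5) + (4 + c)                     ≡⟨ regroup′ i c ⟩
      9 + (c + 8 * i)                           ≤⟨ +-monoʳ-≤ 9 c≤ ⟩
      9 + (8 * b + 9 * a + q)                   ≡⟨ regroup″ b a q ⟩
      8 * b + 9 * (1 + a) + q                   ∎
      where
      open ≤-Reasoning
      regroup : ∀ s c l → 1 + (s + (1 + (1 + (1 + c)))) + 8 * l ≡ (s + 8 * l) + (4 + c)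
      regroup = solve-∀
      regroup′ : ∀ i c → (8 * i + 5) + (4 + c) ≡ 9 + (c + 8 * i)
      regroup′ = solve-∀
      regroup″ : ∀ b a q → 9 + (8 * b + 9 * a + q) ≡ 8 * b + 9 * (1 + a) + q
      regroup″ = solve-∀

  -- The last summand `1 + m` pays for what happens only once, at the end: joining `S₁` to `S₂`, or
  -- the single step on the empty list.
  search-steps : ∀ δ B as lo {m} → All (λ e → length (proj₂ e) ≤ m) as → lo ≤ length B →
                 steps (search δ B (length B) as lo) + 8 * lo ≤ 8 * length B + 9 * length as + (1 + m)
  search-steps δ B [] lo {m} [] lo≤ = begin
    1 + 8 * lo                            ≤⟨ +-mono-≤ (m≤m+n 1 m) (*-monoʳ-≤ 8 lo≤) ⟩
    (1 + m) + 8 * length B                ≡⟨ regroup m (length B) ⟩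
    8 * length B + 9 * 0 + (1 + m)        ∎
    where
    open ≤-Reasoning
    regroup : ∀ m b → (1 + m) + 8 * b ≡ 8 * b + 9 * 0 + (1 + m)
    regroup = solve-∀
  search-steps δ B ((x , S₁) ∷ as) lo {m} (S₁≤m ∷ as≤m) lo≤
    with steps (BinarySearch.locate B (⊖ x) (length B) 0 lo)
       | value (BinarySearch.locate B (⊖ x) (length B) 0 lo)
       | locate-steps B (⊖ x) (length B) 0 lo
       | locate-≤length B (⊖ x) (length B) 0 lo lo≤
  ... | s | i | s≤ | i≤ with at B i
  -- Without an entry the subtraction and the comparison do not take place; the slack 2 restores the
  -- form of `bound`.
  ...   | nothing       = ≤-trans (+-monoˡ-≤ (8 * lo) (s≤s (+-monoʳ-≤ s (s≤s (m≤n+m _ 2)))))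
                                  (bound s lo i (length B) (length as) (1 + m) _ s≤ (search-steps δ B as i as≤m i≤))
  ...   | just (y , S₂) with y ≺? (δ ⊝ x)
  ...     | no  _ = bound s lo i (length B) (length as) (1 + m) _ s≤ (search-steps δ B as i as≤m i≤)
  ...     | yes _ = bound s lo i (length B) (length as) (1 + m) _ s≤ (begin
    steps (appendᵗ S₁ S₂) + 0 + 8 * i               ≡⟨ cong (_+ 8 * i) (trans (+-identityʳ _) (appendᵗ-steps S₁ S₂)) ⟩
    (1 + length S₁) + 8 * i                         ≤⟨ +-mono-≤ (s≤s S₁≤m) (*-monoʳ-≤ 8 i≤) ⟩
    (1 + m) + 8 * length B                          ≡⟨ +-comm (1 + m) _ ⟩
    8 * length B + (1 + m)                          ≤⟨ +-monoˡ-≤ (1 + m) (m≤m+n _ _) ⟩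
    8 * length B + 9 * length as + (1 + m)          ∎)
    where open ≤-Reasoning

  -- Enumerating subsets with their signed sums

  signedSum : Machine → Jobs → Carrier
  signedSum c = listSum (λ j → value (signed c j))

  signed-steps : ∀ c j → steps (signed c j) ≤ 4
  signed-steps c j with σ j Fin.≟ c
  ... | yes _ = s≤s (s≤s (s≤s z≤n))
  ... | no  _ = ≤-refl

  extend-value : ∀ x j es → value (extend x j es) ≡ map (λ (y , S) → x ⊕ y , j ∷ S) es
  extend-value x j []       = refl
  extend-value x j (_ ∷ es) = cong (_ ∷_) (extend-value x j es)

  extend-steps : ∀ x j es → steps (extend x j es) ≡ 1 + 2 * length es
  extend-steps x j []       = refl
  extend-steps x j (_ ∷ es) = trans (cong (λ s → 2 + (s + 0)) (extend-steps x j es)) (regroup (length es))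
    where
    regroup : ∀ l → 2 + (1 + 2 * l + 0) ≡ 1 + 2 * (1 + l)
    regroup = solve-∀

  choose-∷ : ∀ c m j js → value (choose c (suc m) (j ∷ js)) ≡
             map (λ (y , S) → value (signed c j) ⊕ y , j ∷ S) (value (choose c m js)) ++ value (choose c (suc m) js)
  choose-∷ c m j js = trans (appendᵗ-value (value (extend _ j (value (choose c m js)))) _)
    (cong (_++ value (choose c (suc m) js)) (extend-value _ j (value (choose c m js))))

  choose-length : ∀ c m js → length (value (choose c m js)) ≤ leaves m (length js)
  choose-length c zero    js       = ≤-refl
  choose-length c (suc m) []       = z≤n
  choose-length c (suc m) (j ∷ js) = begin
    length (value (choose c (suc m) (j ∷ js)))
      ≡⟨ cong length (choose-∷ c m j js) ⟩
    length (map _ (value (choose c m js)) ++ value (choose c (suc m) js))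
      ≡⟨ length-++ (map _ (value (choose c m js))) ⟩
    length (map _ (value (choose c m js))) + length (value (choose c (suc m) js))
      ≡⟨ cong (_+ _) (length-map _ (value (choose c m js))) ⟩
    length (value (choose c m js)) + length (value (choose c (suc m) js))
      ≤⟨ +-mono-≤ (choose-length c m js) (choose-length c (suc m) js) ⟩
    leaves (suc m) (suc (length js)) ∎
    where open ≤-Reasoning

  -- The surplus 7 is the fixed cost of an inner node: 1 for the tick, 4 for `signed`, 1 each for
  -- the ends of `extend` and `appendᵗ`. Every entry costs 3 more per job added to it, 2 in `extend`
  -- and 1 in `appendᵗ`, whence `3 * m`.
  choose-steps : ∀ c m js → 7 + steps (choose c m js) ≤ (8 + 3 * m) * leaves m (length js)
  choose-steps c zero    js       = ≤-refl
  choose-steps c (suc m) []       = ≤-trans (m≤m+n 8 (3 * suc m)) (≤-reflexive (sym (*-identityʳ _)))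
  choose-steps c (suc m) (j ∷ js) = begin
    7 + (1 + (steps (signed c j) + (s₁ + (steps (extend x j es) + (s₂ + steps (appendᵗ (value (extend x j es)) es′))))))
      ≡⟨ cong₂ (λ a b → 7 + (1 + (steps (signed c j) + (s₁ + (a + (s₂ + b))))))
           (extend-steps x j es)
           (trans (appendᵗ-steps (value (extend x j es)) es′)
                  (cong suc (trans (cong length (extend-value x j es)) (length-map _ es)))) ⟩
    7 + (1 + (steps (signed c j) + (s₁ + (1 + 2 * length es + (s₂ + (1 + length es))))))
      ≤⟨ +-monoʳ-≤ 8 (+-monoˡ-≤ _ (signed-steps c j)) ⟩
    7 + (1 + (4 + (s₁ + (1 + 2 * length es + (s₂ + (1 + length es))))))
      ≡⟨ regroup s₁ s₂ (length es) ⟩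
    (7 + s₁) + (7 + s₂) + 3 * length es
      ≤⟨ +-mono-≤ (+-mono-≤ (choose-steps c m js) (choose-steps c (suc m) js)) (*-monoʳ-≤ 3 (choose-length c m js)) ⟩
    (8 + 3 * m) * a + (8 + 3 * suc m) * b + 3 * a
      ≡⟨ factor m a b ⟩
    (8 + 3 * suc m) * (a + b) ∎
    where
    open ≤-Reasoning
    x   = value (signed c j)
    es  = value (choose c m js)
    es′ = value (choose c (suc m) js)
    s₁  = steps (choose c m js)
    s₂  = steps (choose c (suc m) js)
    a   = leaves m (length js)
    b   = leaves (suc m) (length js)
    regroup : ∀ s t l → 7 + (1 + (4 + (s + (1 + 2 * l + (t + (1 + l)))))) ≡ (7 + s) + (7 + t) + 3 * l
    regroup = solve-∀
    factor : ∀ m a b → (8 + 3 * m) * a + (8 + 3 * (1 + m)) * b + 3 * a ≡ (8 + 3 * (1 + m)) * (a + b)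
    factor = solve-∀

  -- The sublist relation, rather than mere membership, lets uniqueness of `js` pass to `S`.
  Chosen : Machine → ℕ → Jobs → Entry → Set
  Chosen c m js (x , S) = x ≡ signedSum c S × length S ≡ m × S ⊆ js

  choose-sound : ∀ c m js → All (Chosen c m js) (value (choose c m js))
  choose-sound c zero    js       = (refl , refl , minimum js) ∷ []
  choose-sound c (suc m) []       = []
  choose-sound c (suc m) (j ∷ js) = subst (All _) (sym (choose-∷ c m j js)) (All.++⁺
    (All.map⁺ (All.map (λ (x≡ , l≡ , S⊆) → cong (_ ⊕_) x≡ , cong suc l≡ , refl ∷ S⊆) (choose-sound c m js)))
    (All.map (λ (x≡ , l≡ , S⊆) → x≡ , l≡ , j ∷ʳ S⊆) (choose-sound c (suc m) js)))

  choose-complete : ∀ c {S js} → S ⊆ js → (signedSum c S , S) ∈ value (choose c (length S) js)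
  choose-complete c {[]}    _ = here refl
  choose-complete c {s ∷ S} (_∷ʳ_ {ys = js} j S⊆js) =
    subst (_ ∈_) (sym (choose-∷ c (length S) j js)) (∈-++⁺ʳ _ (choose-complete c S⊆js))
  choose-complete c {s ∷ S} (_∷_ {ys = js} refl S⊆js) =
    subst (_ ∈_) (sym (choose-∷ c (length S) s js)) (∈-++⁺ˡ (∈-map⁺ _ (choose-complete c S⊆js)))

  -- One run and the sequence of all runs

  Coloured : Split n → Fin 2 → Entry → Set
  Coloured χ a (_ , S) = All (λ j → χ j ≡ a) S

  coloured? : ∀ χ a → Decidable (Coloured χ a)
  coloured? χ a (_ , S) = All.all? (λ j → χ j Fin.≟ a) S

  contained-value : ∀ χ a x S → value (contained χ a S) ≡ does (coloured? χ a (x , S))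
  contained-value χ a x []      = refl
  contained-value χ a x (j ∷ S) with χ j Fin.≟ a
  ... | yes _ = contained-value χ a x S
  ... | no  _ = refl

  contained-steps : ∀ χ a S → steps (contained χ a S) ≤ 1 + 4 * length S
  contained-steps χ a []      = ≤-refl
  contained-steps χ a (j ∷ S) = ≤-trans (+-monoʳ-≤ 4 rest) (≤-reflexive (regroup (length S)))
    where
    rest : steps (if does (χ j Fin.≟ a) then contained χ a S else return false) ≤ 1 + 4 * length S
    rest with χ j Fin.≟ a
    ... | yes _ = contained-steps χ a S
    ... | no  _ = z≤n
    regroup : ∀ l → 4 + (1 + 4 * l) ≡ 1 + 4 * (1 + l)
    regroup = solve-∀

  select-value : ∀ χ a es → value (select χ a es) ≡ filter (coloured? χ a) es
  select-value χ a []             = refl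
  select-value χ a ((x , S) ∷ es)
    rewrite contained-value χ a x S | select-value χ a es with does (coloured? χ a (x , S))
  ... | true  = refl
  ... | false = refl

  select-steps : ∀ χ a {m} es → All (λ e → length (proj₂ e) ≤ m) es →
                 steps (select χ a es) ≤ 1 + (2 + 4 * m) * length es
  select-steps χ a []             []       = s≤s z≤n
  select-steps χ a {m} ((x , S) ∷ es) (S≤m ∷ es≤m) = begin
    1 + (steps (contained χ a S) + (steps (select χ a es) + 0))
      ≤⟨ s≤s (+-mono-≤ (≤-trans (contained-steps χ a S) (s≤s (*-monoʳ-≤ 4 S≤m)))
                       (+-monoˡ-≤ 0 (select-steps χ a es es≤m))) ⟩
    1 + (1 + 4 * m + (1 + (2 + 4 * m) * length es + 0))
      ≡⟨ regroup m (length es) ⟩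
    1 + (2 + 4 * m) * suc (length es) ∎
    where
    open ≤-Reasoning
    regroup : ∀ m l → 1 + (1 + 4 * m + (1 + (2 + 4 * m) * l + 0)) ≡ 1 + (2 + 4 * m) * (1 + l)
    regroup = solve-∀

  run-≡search : ∀ δ as bs χ → value (run δ as bs χ) ≡
    (let B = filter (coloured? χ 1F) bs in value (search δ B (length B) (filter (coloured? χ 0F) as) 0))
  run-≡search δ as bs χ
    rewrite lengthᵗ-value (value (select χ 1F bs)) | select-value χ 0F as | select-value χ 1F bs = refl

  run-sound : ∀ δ as bs χ {S} → value (run δ as bs χ) ≡ just S →
    ∃₂ λ e e′ → e ∈ as × Coloured χ 0F e × e′ ∈ bs × Coloured χ 1F e′ × Hit δ e e′ × S ≡ proj₂ e ++ proj₂ e′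
  run-sound δ as bs χ found
    with e , e′ , e∈ , e′∈ , rest ← search-sound δ _ _ 0 (trans (sym (run-≡search δ as bs χ)) found)
    with e∈as , e-coloured ← ∈-filter⁻ (coloured? χ 0F) {xs = as} e∈
       | e′∈bs , e′-coloured ← ∈-filter⁻ (coloured? χ 1F) {xs = bs} e′∈
    = e , e′ , e∈as , e-coloured , e′∈bs , e′-coloured , rest

  run-complete : ∀ δ as bs χ → AllPairs _≥ₑ_ as → AllPairs _≤ₑ_ bs → ∀ {e e′} →
    e ∈ as → Coloured χ 0F e → e′ ∈ bs → Coloured χ 1F e′ → Hit δ e e′ →
    ∃ λ S → value (run δ as bs χ) ≡ just S
  run-complete δ as bs χ as-sorted bs-sorted e∈as e-coloured e′∈bs e′-coloured hit
    rewrite run-≡search δ as bs χ =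
    search-complete δ _ _ 0 (AllPairs.filter⁺ (coloured? χ 1F) bs-sorted) (AllPairs.filter⁺ (coloured? χ 0F) as-sorted)
      (All.tabulate λ _ _ ()) (∈-filter⁺ (coloured? χ 0F) e∈as e-coloured)
      (∈-filter⁺ (coloured? χ 1F) e′∈bs e′-coloured) hit

  run-steps : ∀ δ as bs χ {m w} → All (λ e → length (proj₂ e) ≤ m) as → All (λ e → length (proj₂ e) ≤ m) bs →
              length as ≤ w → length bs ≤ w → 1 ≤ w → steps (run δ as bs χ) ≤ (26 + 9 * m) * w
  run-steps δ as bs χ {m} {w} as≤m bs≤m as≤w bs≤w 1≤w = begin
    steps (select χ 0F as) + (steps (select χ 1F bs) + (steps (lengthᵗ B) + steps (search δ B (value (lengthᵗ B)) A 0)))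
      ≡⟨ cong (λ l → steps (select χ 0F as) + (steps (select χ 1F bs) + (steps (lengthᵗ B) + steps (search δ B l A 0))))
           (lengthᵗ-value B) ⟩
    steps (select χ 0F as) + (steps (select χ 1F bs) + (steps (lengthᵗ B) + steps (search δ B (length B) A 0)))
      ≤⟨ +-mono-≤ (select≤ 0F as as≤m as≤w) (+-mono-≤ (select≤ 1F bs bs≤m bs≤w) (+-mono-≤ length≤ search≤)) ⟩
    (1 + (2 + 4 * m) * w) + ((1 + (2 + 4 * m) * w) + ((1 + w) + (8 * w + 9 * w + (1 + m))))
      ≡⟨ regroup m w ⟩
    (22 + 8 * m) * w + (4 + m) * 1
      ≤⟨ +-monoʳ-≤ ((22 + 8 * m) * w) (*-monoʳ-≤ (4 + m) 1≤w) ⟩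
    (22 + 8 * m) * w + (4 + m) * w
      ≡⟨ factor m w ⟩
    (26 + 9 * m) * w ∎
    where
    open ≤-Reasoning
    A = value (select χ 0F as)
    B = value (select χ 1F bs)
    select≤ : ∀ a es → All (λ e → length (proj₂ e) ≤ m) es → length es ≤ w →
              steps (select χ a es) ≤ 1 + (2 + 4 * m) * w
    select≤ a es es≤m es≤w = ≤-trans (select-steps χ a es es≤m) (s≤s (*-monoʳ-≤ (2 + 4 * m) es≤w))
    select-length : ∀ a es → length es ≤ w → length (value (select χ a es)) ≤ w
    select-length a es es≤w = ≤-trans (≤-reflexive (cong length (select-value χ a es)))
      (≤-trans (length-filter (coloured? χ a) es) es≤w)
    length≤ : steps (lengthᵗ B) ≤ 1 + w
    length≤ = ≤-trans (≤-reflexive (lengthᵗ-steps B)) (s≤s (select-length 1F bs bs≤w))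
    A≤m : All (λ e → length (proj₂ e) ≤ m) A
    A≤m = subst (All _) (sym (select-value χ 0F as)) (All.filter⁺ (coloured? χ 0F) as≤m)
    search≤ : steps (search δ B (length B) A 0) ≤ 8 * w + 9 * w + (1 + m)
    search≤ = ≤-trans (m≤m+n _ 0) (≤-trans (search-steps δ B A 0 A≤m z≤n)
      (+-monoˡ-≤ (1 + m) (+-mono-≤ (*-monoʳ-≤ 8 (select-length 1F bs bs≤w)) (*-monoʳ-≤ 9 (select-length 0F as as≤w)))))
    regroup : ∀ m w → (1 + (2 + 4 * m) * w) + ((1 + (2 + 4 * m) * w) + ((1 + w) + (8 * w + 9 * w + (1 + m))))
                      ≡ (22 + 8 * m) * w + (4 + m) * 1
    regroup = solve-∀
    factor : ∀ m w → (22 + 8 * m) * w + (4 + m) * w ≡ (26 + 9 * m) * w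
    factor = solve-∀

  runAll-sound : ∀ δ as bs χs {S} → value (runAll δ as bs χs) ≡ just S → ∃ λ χ → value (run δ as bs χ) ≡ just S
  runAll-sound δ as bs (χ ∷ χs) found with value (run δ as bs χ) in eq
  ... | just _  = χ , trans eq found
  ... | nothing = runAll-sound δ as bs χs found

  runAll-complete : ∀ δ as bs {χs χ} → χ ∈ χs → (∃ λ S → value (run δ as bs χ) ≡ just S) →
                    ∃ λ S → value (runAll δ as bs χs) ≡ just S
  runAll-complete δ as bs {χ ∷ χs} χ∈χs (S , found) with value (run δ as bs χ) in eq | χ∈χs
  ... | just S′ | _          = S′ , refl
  ... | nothing | here refl  = contradiction (trans (sym eq) found) λ ()
  ... | nothing | there χ∈   = runAll-complete δ as bs χ∈ (S , found)

  runAll-steps : ∀ δ as bs χs {r} → (∀ χ → steps (run δ as bs χ) ≤ r) →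
                 steps (runAll δ as bs χs) ≤ 1 + length χs * (1 + r)
  runAll-steps δ as bs []       run≤ = ≤-refl
  runAll-steps δ as bs (χ ∷ χs) {r} run≤ with value (run δ as bs χ)
  ... | just _  = begin
    1 + (steps (run δ as bs χ) + 0)               ≤⟨ s≤s (+-mono-≤ (run≤ χ) z≤n) ⟩
    1 + (r + length χs * (1 + r))                 ≤⟨ n≤1+n _ ⟩
    1 + (1 + r + length χs * (1 + r))             ∎
    where open ≤-Reasoning
  ... | nothing = begin
    1 + (steps (run δ as bs χ) + steps (runAll δ as bs χs))
      ≤⟨ s≤s (+-mono-≤ (run≤ χ) (runAll-steps δ as bs χs run≤)) ⟩
    1 + (r + (1 + length χs * (1 + r)))           ≡⟨ cong suc (+-suc r _) ⟩
    1 + (1 + r + length χs * (1 + r))             ∎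
    where open ≤-Reasoning

  -- Job lists versus subsets; loads

  listSum-++ : ∀ {A : Set} (f : A → Carrier) xs ys → listSum f (xs ++ ys) ≡ listSum f xs ⊕ listSum f ys
  listSum-++ f []       ys = sym (identityˡ _)
  listSum-++ f (x ∷ xs) ys = trans (cong (f x ⊕_) (listSum-++ f xs ys)) (sym (assoc _ _ _))

  listSum-filter-∁ : ∀ {A : Set} (f : A → Carrier) {P : A → Set} (P? : Decidable P) xs →
                     listSum f (filter P? xs) ⊕ listSum f (filter (∁? P?) xs) ≡ listSum f xs
  listSum-filter-∁ f P? []       = identityˡ 0#
  listSum-filter-∁ f P? (x ∷ xs) with P? x
  ... | yes _ = trans (assoc _ _ _) (cong (f x ⊕_) (listSum-filter-∁ f P? xs))
  ... | no  _ = trans (x∙yz≈y∙xz _ _ _) (cong (f x ⊕_) (listSum-filter-∁ f P? xs))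

  ∑-⁅⁆∪ : ∀ {m} {j : Fin m} {S : Subset m} (f : Fin m → Carrier) → j ∉ₛ S → ∑ (⁅ j ⁆ ∪ S) f ≡ f j ⊕ ∑ S f
  ∑-⁅⁆∪ {j = zero}  {inside  ∷ S} f j∉S = ⊥-elim (j∉S here)
  ∑-⁅⁆∪ {j = zero}  {outside ∷ S} f j∉S = cong (λ T → f zero ⊕ ∑ T (f ∘ suc)) (∪-identityˡ S)
  ∑-⁅⁆∪ {j = suc j} {inside  ∷ S} f j∉S =
    trans (cong (f zero ⊕_) (∑-⁅⁆∪ (f ∘ suc) (drop-not-there j∉S))) (x∙yz≈y∙xz _ _ _)
  ∑-⁅⁆∪ {j = suc j} {outside ∷ S} f j∉S = ∑-⁅⁆∪ (f ∘ suc) (drop-not-there j∉S)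

  ∣⁅⁆∪∣ : ∀ {m} {j : Fin m} {S : Subset m} → j ∉ₛ S → ∣ ⁅ j ⁆ ∪ S ∣ ≡ suc ∣ S ∣
  ∣⁅⁆∪∣ {j = zero}  {inside  ∷ S} j∉S = ⊥-elim (j∉S here)
  ∣⁅⁆∪∣ {j = zero}  {outside ∷ S} j∉S = cong (suc ∘ ∣_∣) (∪-identityˡ S)
  ∣⁅⁆∪∣ {j = suc j} {inside  ∷ S} j∉S = cong suc (∣⁅⁆∪∣ (drop-not-there j∉S))
  ∣⁅⁆∪∣ {j = suc j} {outside ∷ S} j∉S = ∣⁅⁆∪∣ (drop-not-there j∉S)

  ∈-toSubset⁺ : ∀ {j js} → j ∈ js → j ∈ₛ toSubset js
  ∈-toSubset⁺ (here refl)  = x∈p∪q⁺ (inj₁ (x∈⁅x⁆ _))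
  ∈-toSubset⁺ (there j∈js) = x∈p∪q⁺ (inj₂ (∈-toSubset⁺ j∈js))

  ∈-toSubset⁻ : ∀ {j} js → j ∈ₛ toSubset js → j ∈ js
  ∈-toSubset⁻ []       j∈ = ⊥-elim (∉⊥ j∈)
  ∈-toSubset⁻ (i ∷ js) j∈ with x∈p∪q⁻ ⁅ i ⁆ (toSubset js) j∈
  ... | inj₁ j∈⁅i⁆ = here (x∈⁅y⁆⇒x≡y i j∈⁅i⁆)
  ... | inj₂ j∈js  = there (∈-toSubset⁻ js j∈js)

  ∉-toSubset : ∀ {j js} → All (j ≢_) js → j ∉ₛ toSubset js
  ∉-toSubset {js = js} j≢ j∈ = All.lookup j≢ (∈-toSubset⁻ js j∈) refl

  -- Uniqueness matters because a repeated job enters the union only once but the list sum several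
  -- times.
  ∑-toSubset : ∀ {js} (f : Fin n → Carrier) → Unique js → ∑ (toSubset js) f ≡ listSum f js
  ∑-toSubset f []          = ∑-⊥ f
    where
    ∑-⊥ : ∀ {m} (f : Fin m → Carrier) → ∑ ⊥ f ≡ 0#
    ∑-⊥ {zero}  f = refl
    ∑-⊥ {suc m} f = ∑-⊥ (f ∘ suc)
  ∑-toSubset f (j≢ ∷ uniq) = trans (∑-⁅⁆∪ f (∉-toSubset j≢)) (cong (f _ ⊕_) (∑-toSubset f uniq))

  ∣toSubset∣ : ∀ {js} → Unique js → ∣ toSubset js ∣ ≡ length js
  ∣toSubset∣ []          = ∣⊥∣≡0 n
  ∣toSubset∣ (j≢ ∷ uniq) = trans (∣⁅⁆∪∣ (∉-toSubset j≢)) (cong suc (∣toSubset∣ uniq))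

  ∈-jobsOn⁺ : ∀ {i j} → σ j ≡ i → j ∈ₛ jobsOn σ i
  ∈-jobsOn⁺ {i} {j} refl = lookup⇒[]= j _ (trans (lookup∘tabulate _ j) (does-refl (σ j)))
    where
    does-refl : ∀ i → does (i Fin.≟ i) ≡ true
    does-refl 0F = refl
    does-refl 1F = refl

  ∈-jobsOn⁻ : ∀ {i j} → j ∈ₛ jobsOn σ i → σ j ≡ i
  ∈-jobsOn⁻ {i} {j} j∈ = does-true (σ j Fin.≟ i) (trans (sym (lookup∘tabulate _ j)) ([]=⇒lookup j∈))

  loadᵗ-value : ∀ i → value (loadᵗ i (allFin n)) ≡ load i
  loadᵗ-value i = go id
    where
    -- Generalised over the embedding `f`, because the tail of a tabulation is the tabulation of
    -- `f ∘ suc`.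
    go : ∀ {m} (f : Fin m → Fin n) →
         value (loadᵗ i (tabulate f)) ≡ ∑ (Vec.tabulate (λ j → does (σ (f j) Fin.≟ i))) (p ∘ f)
    go {zero}  f = refl
    go {suc m} f with σ (f zero) Fin.≟ i
    ... | yes _ = cong (p (f zero) ⊕_) (go (f ∘ suc))
    ... | no  _ = go (f ∘ suc)

  loadᵗ-steps : ∀ i js → steps (loadᵗ i js) ≤ 1 + 5 * length js
  loadᵗ-steps i []       = s≤s z≤n
  loadᵗ-steps i (j ∷ js) = begin
    3 + (steps (loadᵗ i js) + steps (if does (σ j Fin.≟ i) then (step (p j) >>= λ x → x +ᵗ rest) else return rest))
                                            ≤⟨ +-monoʳ-≤ 3 (+-mono-≤ (loadᵗ-steps i js) addition) ⟩
    3 + (1 + 5 * length js + 2)             ≡⟨ regroup (length js) ⟩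
    1 + 5 * suc (length js)                 ∎
    where
    open ≤-Reasoning
    rest = value (loadᵗ i js)
    addition : steps (if does (σ j Fin.≟ i) then (step (p j) >>= λ x → x +ᵗ rest) else return rest) ≤ 2
    addition with σ j Fin.≟ i
    ... | yes _ = ≤-refl
    ... | no  _ = z≤n
    regroup : ∀ l → 3 + (1 + 5 * l + 2) ≡ 1 + 5 * (1 + l)
    regroup = solve-∀

  module _ (c : Machine) where

    on? : Decidable (λ j → σ j ≡ c)
    on? j = σ j Fin.≟ c

    separate-value : ∀ js → value (separate c js) ≡ (filter on? js , filter (∁? on?) js)
    separate-value []       = refl
    separate-value (j ∷ js) with σ j Fin.≟ c
    ... | yes _ = cong (λ (js′ , js″) → j ∷ js′ , js″) (separate-value js)
    ... | no  _ = cong (λ (js′ , js″) → js′ , j ∷ js″) (separate-value js)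

    separate-steps : ∀ js → steps (separate c js) ≡ 1 + 3 * length js
    separate-steps []       = refl
    separate-steps (j ∷ js) = trans (cong (λ s → 3 + (s + 0)) (separate-steps js)) (regroup (length js))
      where
      regroup : ∀ l → 3 + (1 + 3 * l + 0) ≡ 1 + 3 * (1 + l)
      regroup = solve-∀

    signedSum-separate : ∀ js → signedSum c js ≡ listSum p (filter on? js) ⊝ listSum p (filter (∁? on?) js)
    signedSum-separate []       = sym (inverseʳ 0#)
    signedSum-separate (j ∷ js) with σ j Fin.≟ c
    ... | yes _ = trans (cong (p j ⊕_) (signedSum-separate js)) (sym (assoc _ _ _))
    ... | no  _ = begin
      ⊖ p j ⊕ signedSum c js      ≡⟨ cong (⊖ p j ⊕_) (signedSum-separate js) ⟩
      ⊖ p j ⊕ (x ⊕ ⊖ y)           ≡⟨ x∙yz≈y∙xz _ _ _ ⟩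
      x ⊕ (⊖ p j ⊕ ⊖ y)           ≡⟨ cong (x ⊕_) (⁻¹-∙-comm (p j) y) ⟩
      x ⊕ ⊖ (p j ⊕ y)             ∎
      where
      open ≡-Reasoning
      x = listSum p (filter on? js)
      y = listSum p (filter (∁? on?) js)

  opposite-≢ : ∀ {i c : Machine} → i ≢ c → i ≡ opposite c
  opposite-≢ {0F} {0F} i≢c = contradiction refl i≢c
  opposite-≢ {0F} {1F} i≢c = refl
  opposite-≢ {1F} {0F} i≢c = refl
  opposite-≢ {1F} {1F} i≢c = contradiction refl i≢c

  ≢-opposite : ∀ {c : Machine} → opposite c ≢ c
  ≢-opposite {0F} ()
  ≢-opposite {1F} ()

  private
    module Sort≥ = MergeSortProperties _≥ᵗ_
    module Sort≤ = MergeSortProperties _≤ᵗ_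

  -- The critical machine and improving neighbours

  critical : Machine
  critical = if does (load 0F ≺? load 1F) then 1F else 0F

  load-critical : load critical ≡ Lmax
  load-critical with does (load 0F ≺? load 1F)
  ... | true  = refl
  ... | false = refl

  -- With equal loads both machines are critical, but then `Δ` is zero; a positive `Δ` excludes the
  -- tie and makes the choice in `critical` the only one.
  critical-unique : ∀ i → load i ≡ Lmax → 0# ≺ Δ → i ≡ critical
  critical-unique i i≡ 0≺Δ with load 0F ≺? load 1F
  critical-unique 0F i≡ 0≺Δ | yes L₀≺L₁ = contradiction (subst (_≺ load 1F) i≡ L₀≺L₁) ≼-refl
  critical-unique 1F i≡ 0≺Δ | yes _     = refl
  critical-unique 0F i≡ 0≺Δ | no _      = refl
  critical-unique 1F i≡ 0≺Δ | no _      =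
    contradiction (subst (0# ≺_) (trans (cong (load 0F ⊝_) i≡) (inverseʳ _)) 0≺Δ) ≼-refl

  neighbour-sound : ∀ {k S} → Unique S → length S ≡ k → 0# ≺ signedSum critical S → signedSum critical S ≺ Δ →
                    let S′ , S″ = value (separate critical S) in
                    IsImprovingNeighbour k (toSubset S′) (toSubset S″)
  neighbour-sound {k} {S} uniq len 0≺ ≺Δ rewrite separate-value critical S = record
    { machine     = critical
    ; critical    = load-critical
    ; S′-critical = λ j∈ → ∈-jobsOn⁺ (proj₂ (∈-filter⁻ (on? critical) {xs = S} (∈-toSubset⁻ S′ j∈)))
    ; S″-other    = λ j∈ → ∈-jobsOn⁺ (opposite-≢ (proj₂ (∈-filter⁻ (∁? (on? critical)) {xs = S} (∈-toSubset⁻ S″ j∈))))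
    ; size        = trans (cong₂ _+_ (∣toSubset∣ uniq′) (∣toSubset∣ uniq″)) (trans (length-filter-∁ (on? critical) S) len)
    ; positive    = subst (0# ≺_) sum≡ 0≺
    ; bounded     = subst (_≺ Δ) sum≡ ≺Δ
    }
    where
    S′    = filter (on? critical) S
    S″    = filter (∁? (on? critical)) S
    uniq′ = Unique.filter⁺ (on? critical) uniq
    uniq″ = Unique.filter⁺ (∁? (on? critical)) uniq
    sum≡ : signedSum critical S ≡ ∑ (toSubset S′) p ⊝ ∑ (toSubset S″) p
    sum≡ = trans (signedSum-separate critical S) (sym (cong₂ _⊝_ (∑-toSubset p uniq′) (∑-toSubset p uniq″)))

  -- Filtering `allFin n` lists the union of the two sets in the order in which `choose` produces
  -- subsets, so its sublists occur among the chosen entries.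
  neighbour-jobs : ∀ {k S′ S″} → IsImprovingNeighbour k S′ S″ →
                   ∃ λ S → S ⊆ allFin n × length S ≡ k × 0# ≺ signedSum critical S × signedSum critical S ≺ Δ
  neighbour-jobs {k} {S′} {S″} neighbour =
    S , filter-⊆ (_∈ₛ? (S′ ∪ S″)) (allFin n)
      , trans (sym (length-filter-∁ on S)) (trans (cong₂ _+_ length′ length″) size)
      , subst (0# ≺_) (sym sum≡) positive
      , subst (_≺ Δ) (sym sum≡) bounded
    where
    open IsImprovingNeighbour neighbour renaming (critical to machine-critical)
    on = on? critical
    S  = filter (_∈ₛ? (S′ ∪ S″)) (allFin n)

    uniq : Unique S
    uniq = Unique.filter⁺ (_∈ₛ? (S′ ∪ S″)) (Unique.allFin⁺ n)
    uniq′ = Unique.filter⁺ on uniq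
    uniq″ = Unique.filter⁺ (∁? on) uniq

    machine≡ : machine ≡ critical
    -- The gain lies strictly between 0 and `Δ`, so `Δ` is positive.
    machine≡ = critical-unique machine machine-critical (≺-≼-trans positive (≺⇒≼ bounded))

    on-S′ : ∀ {j} → j ∈ₛ S′ → σ j ≡ critical
    on-S′ j∈ = trans (∈-jobsOn⁻ (S′-critical j∈)) machine≡

    on-S″ : ∀ {j} → j ∈ₛ S″ → σ j ≢ critical
    on-S″ j∈ σj≡ = ≢-opposite (trans (sym (∈-jobsOn⁻ (S″-other j∈))) (trans σj≡ (sym machine≡)))

    ∈S : ∀ {j} → j ∈ₛ (S′ ∪ S″) → j ∈ S
    ∈S j∈ = ∈-filter⁺ (_∈ₛ? (S′ ∪ S″)) (∈-allFin _) j∈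

    ∈S⁻ : ∀ {j} → j ∈ S → j ∈ₛ (S′ ∪ S″)
    ∈S⁻ j∈ = proj₂ (∈-filter⁻ (_∈ₛ? (S′ ∪ S″)) {xs = allFin n} j∈)

    toSubset′ : toSubset (filter on S) ≡ S′
    toSubset′ = ⊆-antisym forth (λ j∈ → ∈-toSubset⁺ (∈-filter⁺ on (∈S (x∈p∪q⁺ (inj₁ j∈))) (on-S′ j∈)))
      where
      forth : toSubset (filter on S) ⊆ₛ S′
      forth j∈ with ∈-filter⁻ on {xs = S} (∈-toSubset⁻ (filter on S) j∈)
      ... | j∈S , σj≡ with x∈p∪q⁻ S′ S″ (∈S⁻ j∈S)
      ...   | inj₁ j∈S′ = j∈S′
      ...   | inj₂ j∈S″ = contradiction σj≡ (on-S″ j∈S″)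

    toSubset″ : toSubset (filter (∁? on) S) ≡ S″
    toSubset″ = ⊆-antisym forth (λ j∈ → ∈-toSubset⁺ (∈-filter⁺ (∁? on) (∈S (x∈p∪q⁺ (inj₂ j∈))) (on-S″ j∈)))
      where
      forth : toSubset (filter (∁? on) S) ⊆ₛ S″
      forth j∈ with ∈-filter⁻ (∁? on) {xs = S} (∈-toSubset⁻ (filter (∁? on) S) j∈)
      ... | j∈S , σj≢ with x∈p∪q⁻ S′ S″ (∈S⁻ j∈S)
      ...   | inj₁ j∈S′ = contradiction (on-S′ j∈S′) σj≢
      ...   | inj₂ j∈S″ = j∈S″

    length′ : length (filter on S) ≡ ∣ S′ ∣
    length′ = trans (sym (∣toSubset∣ uniq′)) (cong ∣_∣ toSubset′)

    length″ : length (filter (∁? on) S) ≡ ∣ S″ ∣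
    length″ = trans (sym (∣toSubset∣ uniq″)) (cong ∣_∣ toSubset″)

    sum≡ : signedSum critical S ≡ ∑ S′ p ⊝ ∑ S″ p
    sum≡ = trans (signedSum-separate critical S) (cong₂ _⊝_
      (trans (sym (∑-toSubset p uniq′)) (cong (λ T → ∑ T p) toSubset′))
      (trans (sym (∑-toSubset p uniq″)) (cong (λ T → ∑ T p) toSubset″)))

  -- Correctness of the whole algorithm

  chosen descending ascending : ℕ → List Entry
  chosen     m = value (choose critical m (allFin n))
  descending m = value (MergeSort.sort _≥ᵗ_ (chosen m))
  ascending  m = value (MergeSort.sort _≤ᵗ_ (chosen m))

  ≤ᵗ-true : ∀ e e′ → value (e ≤ᵗ e′) ≡ true → e ≤ₑ e′
  ≤ᵗ-true (x , _) (y , _) h with y ≺? x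
  ... | no y⊀x = y⊀x

  ≤ᵗ-false : ∀ e e′ → value (e ≤ᵗ e′) ≡ false → e′ ≤ₑ e
  ≤ᵗ-false (x , _) (y , _) h with y ≺? x
  ... | yes y≺x = ≺⇒≼ y≺x

  descending-sorted : ∀ m → AllPairs _≥ₑ_ (descending m)
  descending-sorted m = Sort≥.sort-sorted {R = _≥ₑ_} (λ x≥y y≥z → ≼-trans y≥z x≥y)
    (λ e e′ → ≤ᵗ-true e′ e) (λ e e′ → ≤ᵗ-false e′ e) (chosen m)

  ascending-sorted : ∀ m → AllPairs _≤ₑ_ (ascending m)
  ascending-sorted m = Sort≤.sort-sorted {R = _≤ₑ_} ≼-trans ≤ᵗ-true ≤ᵗ-false (chosen m)

  descending-chosen : ∀ m → All (Chosen critical m (allFin n)) (descending m)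
  descending-chosen m = Perm.All-resp-↭ (↭-sym (Sort≥.sort-↭ (chosen m))) (choose-sound critical m (allFin n))

  ascending-chosen : ∀ m → All (Chosen critical m (allFin n)) (ascending m)
  ascending-chosen m = Perm.All-resp-↭ (↭-sym (Sort≤.sort-↭ (chosen m))) (choose-sound critical m (allFin n))

  descending-complete : ∀ {S m} → S ⊆ allFin n → length S ≡ m → (signedSum critical S , S) ∈ descending m
  descending-complete {m = m} S⊆ refl = Perm.∈-resp-↭ (↭-sym (Sort≥.sort-↭ (chosen m))) (choose-complete critical S⊆)

  ascending-complete : ∀ {S m} → S ⊆ allFin n → length S ≡ m → (signedSum critical S , S) ∈ ascending m
  ascending-complete {m = m} S⊆ refl = Perm.∈-resp-↭ (↭-sym (Sort≤.sort-↭ (chosen m))) (choose-complete critical S⊆)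

  module _ {l} (k : ℕ) (H : List (Fin n → Fin l)) where

    found : Maybe Jobs
    found = value (runAll Δ (descending ⌈ k /2⌉) (ascending ⌊ k /2⌋) (splits H))

    -- Rewriting by `loadᵗ-value` turns the computed comparison into that of the loads, so a single
    -- case distinction identifies the local choices of machine and difference with `critical` and
    -- `Δ`. Value and cost depend on the same case distinctions and are therefore treated together.
    derandomizedSwap-unfold :
        value (derandomizedSwap k H) ≡ Maybe.map (λ S → value (separate critical S)) found
      × steps (derandomizedSwap k H) ≡
          steps (loadᵗ 0F (allFin n)) + (steps (loadᵗ 1F (allFin n)) + (1 + (1 +
            (steps (choose critical ⌈ k /2⌉ (allFin n)) + (steps (MergeSort.sort _≥ᵗ_ (chosen ⌈ k /2⌉)) +
            (steps (choose critical ⌊ k /2⌋ (allFin n)) + (steps (MergeSort.sort _≤ᵗ_ (chosen ⌊ k /2⌋)) +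
            (steps (runAll Δ (descending ⌈ k /2⌉) (ascending ⌊ k /2⌋) (splits H)) +
             maybe (λ S → steps (separate critical S) + 0) 0 found))))))))
    derandomizedSwap-unfold rewrite loadᵗ-value 0F | loadᵗ-value 1F with does (load 0F ≺? load 1F)
    derandomizedSwap-unfold | true
      with value (runAll (load 1F ⊝ load 0F)
                         (value (MergeSort.sort _≥ᵗ_ (value (choose 1F ⌈ k /2⌉ (allFin n)))))
                         (value (MergeSort.sort _≤ᵗ_ (value (choose 1F ⌊ k /2⌋ (allFin n)))))
                         (splits H))
    ... | nothing = refl , refl
    ... | just _  = refl , refl
    derandomizedSwap-unfold | false
      with value (runAll (load 0F ⊝ load 1F)
                         (value (MergeSort.sort _≥ᵗ_ (value (choose 0F ⌈ k /2⌉ (allFin n)))))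
                         (value (MergeSort.sort _≤ᵗ_ (value (choose 0F ⌊ k /2⌋ (allFin n)))))
                         (splits H))
    ... | nothing = refl , refl
    ... | just _  = refl , refl

    derandomizedSwap-value : ∀ {m} → found ≡ m →
                             value (derandomizedSwap k H) ≡ Maybe.map (λ S → value (separate critical S)) m
    derandomizedSwap-value refl = proj₁ derandomizedSwap-unfold

    found-sound : ∀ {S} → found ≡ just S →
                  Unique S × length S ≡ k × 0# ≺ signedSum critical S × signedSum critical S ≺ Δ
    found-sound {S} eq
      with χ , eq′ ← runAll-sound Δ _ _ (splits H) eq
      with (x , S₁) , (y , S₂) , e∈ , S₁-coloured , e′∈ , S₂-coloured , (0≺ , ≺Δ) , refl ← run-sound Δ _ _ χ eq′
      with x≡ , len₁ , S₁⊆ ← All.lookup (descending-chosen ⌈ k /2⌉) e∈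
         | y≡ , len₂ , S₂⊆ ← All.lookup (ascending-chosen ⌊ k /2⌋) e′∈ =
        Unique.++⁺ (AllPairs-resp-⊆ S₁⊆ (Unique.allFin⁺ n)) (AllPairs-resp-⊆ S₂⊆ (Unique.allFin⁺ n))
          -- A common job would have both colours.
          (λ (j∈S₁ , j∈S₂) → contradiction (trans (sym (All.lookup S₁-coloured j∈S₁)) (All.lookup S₂-coloured j∈S₂)) λ ())
      , trans (length-++ S₁) (trans (cong₂ _+_ len₁ len₂) (trans (+-comm ⌈ k /2⌉ ⌊ k /2⌋) (⌊n/2⌋+⌈n/2⌉≡n k)))
      , subst (0# ≺_) sum≡ 0≺
      , subst (_≺ Δ) sum≡ ≺Δ
      where
      sum≡ : x ⊕ y ≡ signedSum critical (S₁ ++ S₂)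
      sum≡ = trans (cong₂ _⊕_ x≡ y≡) (sym (listSum-++ _ S₁ S₂))

    found-complete : 2 ≤ k → IsSplitter k H → ∀ {S′ S″} → IsImprovingNeighbour k S′ S″ → ∃ λ S → found ≡ just S
    found-complete 2≤k splitter neighbour
      with S , S⊆ , len , 0≺ , ≺Δ ← neighbour-jobs neighbour
      with h , h∈H , h-inj ← find (splitter (toSubset S) (trans (∣toSubset∣ (AllPairs-resp-⊆ S⊆ (Unique.allFin⁺ n))) len))
      -- Injectivity of `h` on the `k` jobs makes their hash values pairwise distinct, so some
      -- threshold has exactly `⌈ k /2⌉` of them below it.
      with t , len₁ ← threshold h
             (AllPairs-injective (λ i∈ j∈ → h-inj (∈-toSubset⁺ i∈) (∈-toSubset⁺ j∈)) (AllPairs-resp-⊆ S⊆ (Unique.allFin⁺ n)))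
             {⌈ k /2⌉} (subst (⌈ k /2⌉ <_) (sym len) (⌈k/2⌉<k 2≤k)) =
      runAll-complete Δ _ _ (below∈splits t h∈H) (run-complete Δ _ _ _
        (descending-sorted ⌈ k /2⌉) (ascending-sorted ⌊ k /2⌋)
        (descending-complete (⊆-trans (filter-⊆ P? S) S⊆) len₁)
        -- `below t` gives colour 0 exactly to the hash values under `t`, so the two filters of `S`
        -- land in A and B.
        (All.map (λ {j} h<t → cong (if_then 0F else 1F) (dec-true (h j Fin.<? t) h<t)) (All.all-filter P? S))
        (ascending-complete (⊆-trans (filter-⊆ (∁? P?) S) S⊆) len₂)
        (All.map (λ {j} h≮t → cong (if_then 0F else 1F) (dec-false (h j Fin.<? t) h≮t)) (All.all-filter (∁? P?) S))
        (subst (0# ≺_) (sym sum≡) 0≺ , subst (_≺ Δ) (sym sum≡) ≺Δ))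
      where
      P? : Decidable (λ j → h j Fin.< t)
      P? j = h j Fin.<? t
      len₂ : length (filter (∁? P?) S) ≡ ⌊ k /2⌋
      len₂ = +-cancelˡ-≡ ⌈ k /2⌉ _ _ (trans (cong (_+ length (filter (∁? P?) S)) (sym len₁))
        (trans (length-filter-∁ P? S) (trans len (sym (trans (+-comm ⌈ k /2⌉ ⌊ k /2⌋) (⌊n/2⌋+⌈n/2⌉≡n k))))))
      sum≡ : signedSum critical (filter P? S) ⊕ signedSum critical (filter (∁? P?) S) ≡ signedSum critical S
      sum≡ = listSum-filter-∁ _ P? S

    derandomizedSwap-sound : ∀ S′ S″ → value (derandomizedSwap k H) ≡ just (S′ , S″) →
                             IsImprovingNeighbour k (toSubset S′) (toSubset S″)
    derandomizedSwap-sound S′ S″ eq =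
      let S , found≡ , separated = map-just⁻ found (trans (sym (derandomizedSwap-value refl)) eq)
          uniq , len , 0≺ , ≺Δ = found-sound found≡
      in subst (λ (S′ , S″) → IsImprovingNeighbour k (toSubset S′) (toSubset S″)) separated (neighbour-sound uniq len 0≺ ≺Δ)

    derandomizedSwap-complete : 2 ≤ k → IsSplitter k H → ∀ {S′ S″} → IsImprovingNeighbour k S′ S″ →
                                ∃₂ λ S′ S″ → value (derandomizedSwap k H) ≡ just (S′ , S″)
    derandomizedSwap-complete 2≤k splitter neighbour =
      let S , found≡ = found-complete 2≤k splitter neighbour in _ , _ , derandomizedSwap-value found≡

  descending-length : ∀ m → length (descending m) ≡ length (chosen m)
  descending-length m = Perm.↭-length (Sort≥.sort-↭ (chosen m))

  ascending-length : ∀ m → length (ascending m) ≡ length (chosen m)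
  ascending-length m = Perm.↭-length (Sort≤.sort-↭ (chosen m))

  -- Running time of the whole algorithm

  module _ (k : ℕ) (H : List (Fin n → Fin (k ^ 2))) (2≤k : 2 ≤ k) (2≤n : 2 ≤ n) where
    private
      x = n ^ ⌈ k /2⌉
      -- Bounds the length of every list of entries, through `1 + n ^ m ≤ 2 * x`; `e` in turn bounds
      -- the logarithm of `w`, the depth of sorting.
      w = 2 * x
      e = 1 + k * ⌈log₂ n ⌉
      1≤n = <⇒≤ 2≤n

      ⌊k/2⌋≤⌈k/2⌉ = ⌊n/2⌋≤⌈n/2⌉ k

      1≤x : 1 ≤ x
      1≤x = 1≤n⇒1≤n^m ⌈ k /2⌉ 1≤n

      1≤w : 1 ≤ w
      1≤w = ≤-trans 1≤x (m≤m+n x _)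

      n≤x : n ≤ x
      n≤x = begin
        n      ≡⟨ ^-identityʳ n ⟨
        n ^ 1  ≤⟨ ^-monoʳ-≤ n {{>-nonZero 1≤n}} (⌈n/2⌉-mono (<⇒≤ 2≤k)) ⟩
        x      ∎
        where open ≤-Reasoning

      leaves≤w : ∀ m → m ≤ ⌈ k /2⌉ → leaves m (length (allFin n)) ≤ w
      leaves≤w m m≤ = begin
        leaves m (length (allFin n))  ≡⟨ cong (leaves m) (length-tabulate {n = n} id) ⟩
        leaves m n                    ≤⟨ leaves≤1+n^m m n ⟩
        1 + n ^ m                     ≤⟨ +-mono-≤ 1≤x (^-monoʳ-≤ n {{>-nonZero 1≤n}} m≤) ⟩
        x + x                         ≡⟨ cong (x +_) (+-identityʳ x) ⟨
        w                             ∎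
        where open ≤-Reasoning

      log-w≤e : ⌈log₂ w ⌉ ≤ e
      log-w≤e = n≤2^m⇒⌈log₂n⌉≤m {w} {e} (*-monoʳ-≤ 2 (begin
        n ^ ⌈ k /2⌉                    ≤⟨ ^-monoˡ-≤ ⌈ k /2⌉ (n≤2^⌈log₂n⌉ n) ⟩
        (2 ^ ⌈log₂ n ⌉) ^ ⌈ k /2⌉      ≡⟨ ^-*-assoc 2 ⌈log₂ n ⌉ ⌈ k /2⌉ ⟩
        2 ^ (⌈log₂ n ⌉ * ⌈ k /2⌉)      ≤⟨ ^-monoʳ-≤ 2 (*-monoʳ-≤ ⌈log₂ n ⌉ (⌈n/2⌉≤n k)) ⟩
        2 ^ (⌈log₂ n ⌉ * k)            ≡⟨ cong (2 ^_) (*-comm ⌈log₂ n ⌉ k) ⟩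
        2 ^ (k * ⌈log₂ n ⌉)            ∎))
        where open ≤-Reasoning

      choose≤ : ∀ m → m ≤ ⌈ k /2⌉ → steps (choose critical m (allFin n)) ≤ (8 + 3 * k) * w
      choose≤ m m≤ = ≤-trans (m≤n+m _ 7) (≤-trans (choose-steps critical m (allFin n))
        (*-mono-≤ (+-monoʳ-≤ 8 (*-monoʳ-≤ 3 (≤-trans m≤ (⌈n/2⌉≤n k)))) (leaves≤w m m≤)))

      chosen≤ : ∀ m → m ≤ ⌈ k /2⌉ → length (chosen m) ≤ w
      chosen≤ m m≤ = ≤-trans (choose-length critical m (allFin n)) (leaves≤w m m≤)

      jobs≤ : ∀ {m es} → m ≤ ⌈ k /2⌉ → All (Chosen critical m (allFin n)) es → All (λ e → length (proj₂ e) ≤ k) es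
      jobs≤ m≤ = All.map λ (_ , len , _) → ≤-trans (≤-reflexive len) (≤-trans m≤ (⌈n/2⌉≤n k))

      runAll≤ : steps (runAll Δ (descending ⌈ k /2⌉) (ascending ⌊ k /2⌋) (splits H))
                ≤ 1 + length H * (k ^ 2 + k ^ 2) * (1 + (26 + 9 * k) * w)
      runAll≤ = subst
        (λ s → steps (runAll Δ (descending ⌈ k /2⌉) (ascending ⌊ k /2⌋) (splits H)) ≤ 1 + s * (1 + (26 + 9 * k) * w))
        (splits-length H)
        (runAll-steps Δ (descending ⌈ k /2⌉) (ascending ⌊ k /2⌋) (splits H)
          (λ χ → run-steps Δ (descending ⌈ k /2⌉) (ascending ⌊ k /2⌋) χ
            (jobs≤ ≤-refl (descending-chosen ⌈ k /2⌉)) (jobs≤ ⌊k/2⌋≤⌈k/2⌉ (ascending-chosen ⌊ k /2⌋))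
            (≤-trans (≤-reflexive (descending-length ⌈ k /2⌉)) (chosen≤ _ ≤-refl))
            (≤-trans (≤-reflexive (ascending-length ⌊ k /2⌋)) (chosen≤ _ ⌊k/2⌋≤⌈k/2⌉))
            1≤w))

      -- The cost of `separate` is linear in the number of jobs found, and `found-sound` fixes that
      -- number to be `k`.
      finish≤ : maybe (λ S → steps (separate critical S) + 0) 0 (found k H) ≤ 1 + 3 * k
      finish≤ = maybe-≤ (found k H) λ {S} found≡ → ≤-reflexive (trans (+-identityʳ _) (trans (separate-steps critical S)
        (cong (λ l → 1 + 3 * l) (proj₁ (proj₂ (found-sound k H found≡))))))

      load≤ : ∀ i → steps (loadᵗ i (allFin n)) ≤ 1 + 5 * n
      load≤ i = ≤-trans (loadᵗ-steps i (allFin n)) (≤-reflexive (cong (λ l → 1 + 5 * l) (length-tabulate {n = n} id)))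

    -- The bound is a product, so its logarithms must not vanish: for `n ≡ 1` it would be zero.
    -- `2 ≤ n` and `2 ≤ k` make both logarithms at least 1.
    derandomizedSwap-steps : ∀ a → length H ≤ a * (k ^ 6 * ⌈log₂ k ⌉ * ⌈log₂ n ⌉) →
      steps (derandomizedSwap k H) ≤ (142 + 144 * a) * (k ^ 9 * x * ⌈log₂ n ⌉ * ⌈log₂ k ⌉)
    derandomizedSwap-steps a H≤ = ≤-trans (≤-trans (≤-reflexive (proj₂ (derandomizedSwap-unfold k H)))
      (+-mono-≤ (load≤ 0F) (+-mono-≤ (load≤ 1F) (s≤s (s≤s
        (+-mono-≤ (choose≤ ⌈ k /2⌉ ≤-refl)
        (+-mono-≤ (Sort≥.sort-steps (λ _ _ → ≤-refl) (chosen ⌈ k /2⌉) (chosen≤ _ ≤-refl) 1≤w log-w≤e)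
        (+-mono-≤ (choose≤ ⌊ k /2⌋ ⌊k/2⌋≤⌈k/2⌉)
        (+-mono-≤ (Sort≤.sort-steps (λ _ _ → ≤-refl) (chosen ⌊ k /2⌋) (chosen≤ _ ⌊k/2⌋≤⌈k/2⌉) 1≤w log-w≤e)
        (+-mono-≤ runAll≤ finish≤))))))))))
      (total-bound k n x ⌈log₂ n ⌉ ⌈log₂ k ⌉ (length H) a refl refl
        (<⇒≤ 2≤k) (⌈log₂⌉-mono-≤ 2≤n) (⌈log₂⌉-mono-≤ 2≤k) 1≤x n≤x H≤)

open OrderedAbelianGroup using (Carrier; 0#)
open TwoMachines using (IsImprovingNeighbour; toSubset; derandomizedSwap)

theorem2 : ∀ (a : ℕ) → ∃ λ (b : ℕ) →
    ∀ (𝔾 : OrderedAbelianGroup) (n k : ℕ) → 2 ≤ k →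
    (p : Fin n → Carrier 𝔾) → (∀ j → OrderedAbelianGroup._<_ 𝔾 (0# 𝔾) (p j)) →
    (σ : Schedule n) →
    (H : List (Fin n → Fin (k ^ 2))) → IsSplitter k H →
    length H ≤ a * (k ^ 6 * ⌈log₂ k ⌉ * ⌈log₂ n ⌉) →
    (∀ S′ S″ → value (derandomizedSwap 𝔾 p σ k H) ≡ just (S′ , S″) →
    IsImprovingNeighbour 𝔾 p σ k (toSubset 𝔾 p σ S′) (toSubset 𝔾 p σ S″))
    × ((∃₂ λ (S′ S″ : Subset n) → IsImprovingNeighbour 𝔾 p σ k S′ S″) →
    ∃₂ λ S′ S″ → value (derandomizedSwap 𝔾 p σ k H) ≡ just (S′ , S″))
    × (2 ≤ n → steps (derandomizedSwap 𝔾 p σ k H)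
    ≤ b * (k ^ 9 * n ^ ⌈ k /2⌉ * ⌈log₂ n ⌉ * ⌈log₂ k ⌉))
theorem2 a = 142 + 144 * a , λ 𝔾 n k 2≤k p _ σ H splitter H≤ →
  let open SwapProperties 𝔾 p σ in
    derandomizedSwap-sound k H
  , (λ (_ , _ , neighbour) → derandomizedSwap-complete k H 2≤k splitter neighbour)
  , (λ 2≤n → derandomizedSwap-steps k H 2≤k 2≤n a H≤)
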